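{- Let $T$ be a rooted tree with $n$ leaves and no node having exactly one child, such that every leaf child set has size at most $k$, at most one leaf child set has odd size, and if there exists a node $v^*$ whose leaf child set $\Lambda(v^*)$ has odd size, then every ancestor of $v^*$ has an empty leaf child set. Then the query complexity in the comparison-query model of inversion minimization on $T$ is at least $\log_2(n!)-O(k\log k)$. In particular, this lower bound applies to perfect trees of even degree $k$, and to full binary trees ($k=2$) with at most one leaf that has no sibling leaf.
   Context: The leaf child set $\Lambda(v)$ of a node $v$ of a rooted tree is the set of children of $v$ that are leaves. A ranking of a set $X$ of $n$ items is a bijection $\rho:X\to\{1,\dots,n\}$; an inversion of a ranking $\sigma$ with respect to $\rho$ is a pair $x_1,x_2$ with $\rho(x_1)<\rho(x_2)$ and $\sigma(x_1)>\sigma(x_2)$, and $\mathrm{Inv}_\rho(\sigma)$ counts them. An ordering of $T$ (a left-to-right order of the children of each internal node) induces a left-to-right ranking $\sigma$ of the leaves; $\mathrm{MInv}(T,\rho)$ is the minimum of $\mathrm{Inv}_\rho(\sigma)$ over orderings. Inversion minimization on $T$: given ranking $\rho$ of the leaves, output $\mathrm{MInv}(T,\rho)$. In the comparison-query model, algorithms access $\rho$ only through queries "is $\rho(x_1)<\rho(x_2)$?"; query complexity is the minimum over correct deterministic algorithms of the worst-case number of queries. A tree of degree $k$ is full if every node has $0$ or $k$ children, and perfect if it is full and all leaves have the same depth. -}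

module Defs where

open import Data.Nat using (ℕ; zero; suc; _+_; _<_; _≤_; _<?_; _≟_; _%_)
open import Data.Fin using (Fin; toℕ)
open import Data.List using (List; []; _∷_; _++_; length; filter; concat)
open import Data.List.Relation.Unary.All using (All)
open import Data.List.Relation.Unary.Any using (Any)
open import Data.List.Relation.Binary.Permutation.Propositional using (_↭_)
open import Data.List.Relation.Binary.Pointwise using (Pointwise)
open import Data.Fin.Permutation using (Permutation′; _⟨$⟩ʳ_)
open import Data.Product using (Σ; _×_)
open import Relation.Binary.PropositionalEquality using (_≡_)
open import Relation.Nullary using (does)
open import Data.Bool using (Bool; true; false; if_then_else_)

-- Rooted trees whose leaves carry labels (the leaf set is identified
-- with the labels).  Children of a node are given as a list; the order
-- of that list is irrelevant (orderings are quantified over below).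

data LTree (A : Set) : Set where
  leaf : A → LTree A
  node : List (LTree A) → LTree A

module _ {A : Set} where

  isLeaf : LTree A → Bool
  isLeaf (leaf _) = true
  isLeaf (node _) = false

  leafChildCount : List (LTree A) → ℕ
  leafChildCount [] = 0
  leafChildCount (t ∷ ts) = (if isLeaf t then 1 else 0) + leafChildCount ts

  mutual
    leaves : LTree A → List A
    leaves (leaf x) = x ∷ []
    leaves (node ts) = leavesF ts

    leavesF : List (LTree A) → List A
    leavesF [] = []
    leavesF (t ∷ ts) = leaves t ++ leavesF ts

  mutual
    lcsList : LTree A → List ℕ
    lcsList (leaf _) = []
    lcsList (node ts) = leafChildCount ts ∷ lcsListF ts

    lcsListF : List (LTree A) → List ℕ
    lcsListF [] = []
    lcsListF (t ∷ ts) = lcsList t ++ lcsListF ts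

  -- no node has exactly one child (and an internal node, i.e. a non-leaf,
  -- has at least one child; childless nodes are the labelled leaves)
  data NoUnary : LTree A → Set where
    nu-leaf : ∀ {x} → NoUnary (leaf x)
    nu-node : ∀ {ts} → 2 ≤ length ts → All NoUnary ts → NoUnary (node ts)

  HasOdd : LTree A → Set
  HasOdd t = Any (λ m → m % 2 ≡ 1) (lcsList t)

  data AncestorsEmpty : LTree A → Set where
    ae-leaf : ∀ {x} → AncestorsEmpty (leaf x)
    ae-node : ∀ {ts} → All AncestorsEmpty ts →
              (Any HasOdd ts → leafChildCount ts ≡ 0) →
              AncestorsEmpty (node ts)

  oddCount : LTree A → ℕ
  oddCount t = length (filter (λ m → m % 2 ≟ 1) (lcsList t))

  data Yields : LTree A → List A → Set where
    y-leaf : ∀ {x} → Yields (leaf x) (x ∷ [])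
    y-node : ∀ {ts ts′ σs} → ts′ ↭ ts → Pointwise Yields ts′ σs →
             Yields (node ts) (concat σs)

module _ {n : ℕ} (ρ : Permutation′ n) where

  rk : Fin n → ℕ
  rk x = toℕ (ρ ⟨$⟩ʳ x)

  countBelow : Fin n → List (Fin n) → ℕ
  countBelow x [] = 0
  countBelow x (y ∷ ys) = (if does (rk y <? rk x) then 1 else 0) + countBelow x ys

  Inv : List (Fin n) → ℕ
  Inv [] = 0
  Inv (x ∷ xs) = countBelow x xs + Inv xs

IsMInv : {n : ℕ} → LTree (Fin n) → Permutation′ n → ℕ → Set
IsMInv T ρ m =
  Σ (List _) (λ σ → Yields T σ × Inv ρ σ ≡ m) ×
  (∀ σ → Yields T σ → m ≤ Inv ρ σ)

data DTree (n : ℕ) : Set where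
  output : ℕ → DTree n
  query  : Fin n → Fin n → DTree n → DTree n → DTree n

module _ {n : ℕ} (ρ : Permutation′ n) where

  run : DTree n → ℕ
  run (output m) = m
  run (query i j yes no) = if does (rk ρ i <? rk ρ j) then run yes else run no

  cost : DTree n → ℕ
  cost (output m) = 0
  cost (query i j yes no) = suc (if does (rk ρ i <? rk ρ j) then cost yes else cost no)

SolvesMInv : {n : ℕ} → LTree (Fin n) → DTree n → Set
SolvesMInv T D = ∀ ρ → IsMInv T ρ (run ρ D)

{-# OPTIONS --safe #-}

-- Exchanging two leaves of consecutive rank that are not siblings changes the parity of MInv:
-- sibling leaves are never inverted in an optimal ordering, and among the inversions between
-- non-siblings the parity does not depend on the ordering, because two children of a node that
-- are not both leaves have an even product of leaf counts.  Hence the rankings reaching a given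
-- leaf of a correct decision tree D never differ by such an exchange.  Reading these rankings as
-- words, a prefix can be continued in several ways only by leaves that are all siblings, and each
-- of them is then followed by another sibling, so at most k ^ m of these rankings have at most m
-- pairs of siblings in consecutive position.  A random ranking has O(k) such pairs on average,
-- so by Markov's inequality half of all rankings have at most 4 k of them, and
-- n ! / 2 ≤ 2 ^ depth D * k ^ (4 k) follows.
module Submission where

open import Defs
open import Data.Bool using (Bool; if_then_else_; true; false)
open import Data.Empty using (⊥; ⊥-elim)
open import Data.Fin as Fin using (Fin; toℕ; fromℕ<)
open import Data.Fin.Permutation using (Permutation′; permutation)
open import Data.Fin.Properties using (toℕ-injective; toℕ-fromℕ<; toℕ-cast)
open import Data.List using (List; []; _∷_; [_]; _++_; length; map; concat; concatMap; filter; lookup; allFin)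
open import Data.List.Membership.Propositional using (_∈_; _∉_; lose; find)
open import Data.List.Membership.Propositional.Properties
  using (∈-++⁺ˡ; ∈-++⁺ʳ; ∈-++⁻; ∈-concat⁺′; ∈-concat⁻′; ∈-∃++; ∈-filter⁻; ∈-allFin; ∈-lookup; ∈-map⁺; ∈-map⁻)
open import Data.List.Properties
  using (++-assoc; length-tabulate; ∷-injectiveʳ; ∷-injectiveˡ; map-++; concat-++; length-++; filter-++; filter-some;
         length-map; filter-all; filter-accept; filter-reject; map-cong; map-cong-local)
open import Data.List.Relation.Binary.Permutation.Propositional renaming (trans to ↭trans)
open import Data.List.Relation.Binary.Permutation.Propositional.Properties
  using (++⁺; ++⁺ˡ; ++⁺ʳ; shift; shifts; All-resp-↭; ∈-resp-↭; ↭-length; map⁺)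
open import Data.List.Relation.Binary.Permutation.Setoid.Properties using (AllPairs-resp-↭)
open import Data.List.Relation.Binary.Pointwise using (Pointwise; []; _∷_)
open import Data.List.Relation.Unary.All as All using (All; []; _∷_)
open import Data.List.Relation.Unary.All.Properties as All using (¬Any⇒All¬)
open import Data.List.Relation.Unary.AllPairs using (AllPairs; []; _∷_)
open import Data.List.Relation.Unary.Any as Any using (Any; here; there)
open import Data.List.Relation.Unary.Unique.Propositional using (Unique)
open import Data.List.Relation.Unary.Unique.Propositional.Properties as Unique using (allFin⁺)
open import Data.Nat as ℕ hiding (_≟_)
open import Data.Nat.Induction using (<-rec)
open import Data.Nat.ListAction using (sum)
open import Data.Nat.ListAction.Properties using (sum-++; sum-↭)
open import Data.Nat.Logarithm using (⌈log₂_⌉; ⌈log₂⌉-mono-≤; ⌈log₂⌈n/2⌉⌉≡⌈log₂n⌉∸1)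
open import Data.Nat.Properties hiding (_≟_)
open import Data.Nat.Tactic.RingSolver using (solve-∀)
open import Data.Parity.Base as ℙ using (0ℙ; 1ℙ)
open import Data.Parity.Properties using (+-homo-+; *-homo-*)
open import Data.Product using (Σ; Σ-syntax; ∃-syntax; ∃₂; _×_; _,_; proj₁; proj₂)
open import Data.Product.Properties using (≡-dec)
open import Data.Sum using (_⊎_; inj₁; inj₂)
open import Function using (_∘_)
open import Function.Bundles using (Injection)
open import Function.Properties.Inverse using (↔⇒↣)
open import Relation.Binary using (Decidable; Symmetric; Transitive; DecidableEquality)
open import Relation.Binary.PropositionalEquality hiding ([_])
open import Relation.Nullary
open import Relation.Nullary.Decidable using (dec-true; dec-false; decidable-stable)
import Data.Bool.Properties as Bool
import Data.List.Relation.Binary.Permutation.Setoid.Properties as ↭ₛ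
open import Algebra.Properties.CommutativeSemigroup +-commutativeSemigroup using (interchange; x∙yz≈y∙xz)

-- Sums over pairs and their parity

-- The obstacle is that exchanging two siblings of consecutive rank is a symmetry of the tree and
-- leaves MInv unchanged, so one leaf of `D` may hold many rankings; the adjacencies of siblings are
-- what this multiplicity is charged to. All that is known about the rankings in a leaf is that they
-- agree with the recorded answers. That suffices: if one of them puts `y` before `z` and another
-- has `z` directly before `y`, no answer on the path concerns this pair, and exchanging it stays in
-- the leaf. Two words `p x ...` and `p y ...` of one leaf disagree about `y` and every letter from
-- `x` up to `y` in the first word. So `y` can be carried forward to just behind `x` and then past
-- `x`, all inside the leaf, and parity applied to the last exchange makes `x` and `y` siblings.
-- Constants: inserting a letter creates at most two adjacencies per sibling, hence at most 2 k on
-- average, and Markov's inequality doubles this to 4 k. The bound is obtained for the cost on one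
-- concrete ranking, which follows the majority answers.

module _ {A : Set} where

  row : (A → A → ℕ) → A → List A → ℕ
  row f x ys = sum (map (f x) ys)

  cross : (A → A → ℕ) → List A → List A → ℕ
  cross f xs ys = sum (map (λ x → row f x ys) xs)

  pairs : (A → A → ℕ) → List A → ℕ
  pairs f []       = 0
  pairs f (x ∷ xs) = row f x xs + pairs f xs

  row-++ : ∀ f x ys zs → row f x (ys ++ zs) ≡ row f x ys + row f x zs
  row-++ f x ys zs = trans (cong sum (map-++ (f x) ys zs)) (sum-++ (map (f x) ys) _)

  row-↭ : ∀ f x {ys zs} → ys ↭ zs → row f x ys ≡ row f x zs
  row-↭ f x p = sum-↭ (map⁺ (f x) p)

  cross-++ʳ : ∀ f xs ys zs → cross f xs (ys ++ zs) ≡ cross f xs ys + cross f xs zs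
  cross-++ʳ f []       ys zs = refl
  cross-++ʳ f (x ∷ xs) ys zs = trans (cong₂ _+_ (row-++ f x ys zs) (cross-++ʳ f xs ys zs))
    (interchange (row f x ys) (row f x zs) (cross f xs ys) (cross f xs zs))

  cross-↭ : ∀ f {xs xs′ ys ys′} → xs ↭ xs′ → ys ↭ ys′ → cross f xs ys ≡ cross f xs′ ys′
  cross-↭ f {xs′ = xs′} p q = trans (sum-↭ (map⁺ _ p)) (cong sum (map-cong (λ x → row-↭ f x q) xs′))

  pairs-++ : ∀ f xs ys → pairs f (xs ++ ys) ≡ (pairs f xs + pairs f ys) + cross f xs ys
  pairs-++ f []       ys = sym (+-identityʳ _)
  pairs-++ f (x ∷ xs) ys = trans (cong₂ _+_ (row-++ f x xs ys) (pairs-++ f xs ys))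
    (rearrange (row f x xs) (row f x ys) (pairs f xs) (pairs f ys) (cross f xs ys))
    where
    rearrange : ∀ a b c d e → (a + b) + ((c + d) + e) ≡ ((a + c) + d) + (b + e)
    rearrange = solve-∀

  row-cong : ∀ f g x ys → (∀ {y} → y ∈ ys → f x y ≡ g x y) → row f x ys ≡ row g x ys
  row-cong f g x ys h = cong sum (map-cong-local (All.tabulate h))

  pairs-cong : ∀ f g xs → (∀ {x y} → x ∈ xs → y ∈ xs → f x y ≡ g x y) → pairs f xs ≡ pairs g xs
  pairs-cong f g []       h = refl
  pairs-cong f g (x ∷ xs) h =
    cong₂ _+_ (row-cong f g x xs λ y∈ → h (here refl) (there y∈)) (pairs-cong f g xs λ x∈ y∈ → h (there x∈) (there y∈))

  row-+ : ∀ f g x ys → row (λ a b → f a b + g a b) x ys ≡ row f x ys + row g x ys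
  row-+ f g x []       = refl
  row-+ f g x (y ∷ ys) = trans (cong (_ +_) (row-+ f g x ys)) (interchange (f x y) (g x y) _ _)

  pairs-+ : ∀ f g xs → pairs (λ a b → f a b + g a b) xs ≡ pairs f xs + pairs g xs
  pairs-+ f g []       = refl
  pairs-+ f g (x ∷ xs) = trans (cong₂ _+_ (row-+ f g x xs) (pairs-+ f g xs)) (interchange (row f x xs) (row g x xs) _ _)

  row-zero : ∀ f x ys → (∀ {y} → y ∈ ys → f x y ≡ 0) → row f x ys ≡ 0
  row-zero f x []       h = refl
  row-zero f x (y ∷ ys) h = cong₂ _+_ (h (here refl)) (row-zero f x ys (h ∘ there))

  cross-zero : ∀ f xs ys → (∀ {x y} → x ∈ xs → y ∈ ys → f x y ≡ 0) → cross f xs ys ≡ 0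
  cross-zero f []       ys h = refl
  cross-zero f (x ∷ xs) ys h = cong₂ _+_ (row-zero f x ys (h (here refl))) (cross-zero f xs ys (h ∘ there))

  -- Exactly one order of each pair is counted. When the product of the lengths is even, the two
  -- cross counts thus have equal parity, and two adjacent blocks can trade places unnoticed modulo
  -- two.
  cross-sum : ∀ f xs ys → (∀ {x y} → x ∈ xs → y ∈ ys → f x y + f y x ≡ 1) →
              cross f xs ys + cross f ys xs ≡ length xs * length ys
  cross-sum f [] ys h = cross-[] ys
    where
    cross-[] : ∀ ys → cross f ys [] ≡ 0
    cross-[] ys = cross-zero f ys [] (λ _ ())
  cross-sum f (x ∷ xs) ys h = begin
    (row f x ys + cross f xs ys) + cross f ys (x ∷ xs)
      ≡⟨ cong ((row f x ys + cross f xs ys) +_) (cross-++ʳ f ys (x ∷ []) xs) ⟩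
    (row f x ys + cross f xs ys) + (cross f ys (x ∷ []) + cross f ys xs)
      ≡⟨ interchange (row f x ys) (cross f xs ys) (cross f ys (x ∷ [])) (cross f ys xs) ⟩
    (row f x ys + cross f ys (x ∷ [])) + (cross f xs ys + cross f ys xs)
      ≡⟨ cong₂ _+_ (column ys (h (here refl))) (cross-sum f xs ys (h ∘ there)) ⟩
    length ys + length xs * length ys                                  ∎
    where
    open ≡-Reasoning
    lem′ : ∀ a b c d → (a + b) + ((c + 0) + d) ≡ (a + c) + (b + d)
    lem′ = solve-∀
    column : ∀ ys → (∀ {y} → y ∈ ys → f x y + f y x ≡ 1) → row f x ys + cross f ys (x ∷ []) ≡ length ys
    column []       h = refl
    column (y ∷ ys) h = trans (lem′ (f x y) (row f x ys) (f y x) _) (cong₂ _+_ (h (here refl)) (column ys (h ∘ there)))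

infix 4 _≡₂_
_≡₂_ : ℕ → ℕ → Set
m ≡₂ n = parity m ≡ parity n

≡₂-+ : ∀ a b c d → a ≡₂ b → c ≡₂ d → a + c ≡₂ b + d
≡₂-+ a b c d p q = trans (+-homo-+ a c) (trans (cong₂ ℙ._+_ p q) (sym (+-homo-+ b d)))

sum-even⇒≡₂ : ∀ a b → parity (a + b) ≡ 0ℙ → a ≡₂ b
sum-even⇒≡₂ a b p with parity a | parity b | trans (sym (+-homo-+ a b)) p
... | 0ℙ | 0ℙ | _ = refl
... | 1ℙ | 1ℙ | _ = refl

n≢₂1+n : ∀ n → ¬ (n ≡₂ suc n)
n≢₂1+n (suc zero) ()
n≢₂1+n (suc (suc n)) p = n≢₂1+n n p

module _ {A : Set} (f g : A → A → ℕ) where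

  row-flip : ∀ {a b zs} → (∀ {c} → c ≢ b → f a c ≡ g a c) → f a b ≡₂ suc (g a b) →
             Unique zs → b ∈ zs → row f a zs ≡₂ suc (row g a zs)
  row-flip {a} {b} {_ ∷ zs} eq fl (z∉ ∷ _) (here refl) =
    ≡₂-+ (f a b) (suc (g a b)) (row f a zs) (row g a zs) fl
      (cong parity (row-cong f g a zs λ c∈ → eq λ { refl → All.lookup z∉ c∈ refl }))
  row-flip {a} {b} {z ∷ zs} eq fl (z∉ ∷ u) (there b∈) = begin
    parity (f a z + row f a zs)       ≡⟨ ≡₂-+ (f a z) (g a z) (row f a zs) (suc (row g a zs))
                                           (cong parity (eq (All.lookup z∉ b∈))) (row-flip eq fl u b∈) ⟩
    parity (g a z + suc (row g a zs)) ≡⟨ cong parity (+-suc (g a z) _) ⟩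
    parity (suc (g a z + row g a zs)) ∎
    where open ≡-Reasoning

  module _ {x y : A} (x≢y : x ≢ y)
           (agree : ∀ {a b} → (a , b) ≢ (x , y) → (a , b) ≢ (y , x) → f a b ≡ g a b)
           (flip-xy : f x y ≡₂ suc (g x y)) (flip-yx : f y x ≡₂ suc (g y x)) where

    -- A duplicate-free list contributes only one of the summands at `(x , y)` and `(y , x)`,
    -- depending on which letter comes first. Either one flips, and all other summands agree.
    pairs-flip : ∀ {zs} → Unique zs → x ∈ zs → y ∈ zs → pairs f zs ≡₂ suc (pairs g zs)
    pairs-flip _ (here refl) (here refl) = ⊥-elim (x≢y refl)
    pairs-flip {_ ∷ zs} (z∉ ∷ u) (here refl) (there y∈) =
      ≡₂-+ (row f x zs) (suc (row g x zs)) (pairs f zs) (pairs g zs)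
        (row-flip (λ c≢y → agree (λ { refl → c≢y refl }) (λ { refl → x≢y refl })) flip-xy u y∈)
        (cong parity (pairs-cong f g zs λ a∈ b∈ →
          agree (λ { refl → All.lookup z∉ a∈ refl }) (λ { refl → All.lookup z∉ b∈ refl })))
    pairs-flip {_ ∷ zs} (z∉ ∷ u) (there x∈) (here refl) =
      ≡₂-+ (row f y zs) (suc (row g y zs)) (pairs f zs) (pairs g zs)
        (row-flip (λ c≢x → agree (λ { refl → x≢y refl }) (λ { refl → c≢x refl })) flip-yx u x∈)
        (cong parity (pairs-cong f g zs λ a∈ b∈ →
          agree (λ { refl → All.lookup z∉ b∈ refl }) (λ { refl → All.lookup z∉ a∈ refl })))
    pairs-flip {z ∷ zs} (z∉ ∷ u) (there x∈) (there y∈) = begin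
      parity (row f z zs + pairs f zs)       ≡⟨ ≡₂-+ (row f z zs) (row g z zs) (pairs f zs) (suc (pairs g zs))
        (cong parity (row-cong f g z zs λ _ →
          agree (λ { refl → All.lookup z∉ x∈ refl }) (λ { refl → All.lookup z∉ y∈ refl })))
        (pairs-flip u x∈ y∈) ⟩
      parity (row g z zs + suc (pairs g zs)) ≡⟨ cong parity (+-suc (row g z zs) _) ⟩
      parity (suc (row g z zs + pairs g zs)) ∎
      where open ≡-Reasoning

-- Inversions of an ordering

module _ {A : Set} where

  leavesF-↭ : {ts us : List (LTree A)} → ts ↭ us → leavesF ts ↭ leavesF us
  leavesF-↭ refl = refl
  leavesF-↭ (prep t p) = ++⁺ˡ (leaves t) (leavesF-↭ p)
  leavesF-↭ (swap t u p) = ↭trans (shifts (leaves t) (leaves u)) (++⁺ˡ (leaves u) (++⁺ˡ (leaves t) (leavesF-↭ p)))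
  leavesF-↭ (↭trans p q) = ↭trans (leavesF-↭ p) (leavesF-↭ q)

  mutual
    yields-↭ : ∀ {T : LTree A} {σ} → Yields T σ → σ ↭ leaves T
    yields-↭ y-leaf = refl
    yields-↭ (y-node p ys) = ↭trans (yieldsF-↭ ys) (leavesF-↭ p)

    yieldsF-↭ : ∀ {ts : List (LTree A)} {σs} → Pointwise Yields ts σs → concat σs ↭ leavesF ts
    yieldsF-↭ [] = refl
    yieldsF-↭ (y ∷ ys) = ++⁺ (yields-↭ y) (yieldsF-↭ ys)

-- Parity of the minimum number of inversions, for an abstract sibling relation

module Siblings {A : Set} {_~_ : A → A → Set} (~-sym : Symmetric _~_) (_~?_ : Decidable _~_) where

  -- What parity requires of two children of a node: either both are leaves, whose mutual inversion
  -- `nonsib` ignores, or no sibling relation crosses between them and exchanging the two blocks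
  -- changes the inversions by an even amount.
  data Pair : LTree A → LTree A → Set where
    siblings : ∀ {x y} → x ~ y → Pair (leaf x) (leaf y)
    apart    : ∀ {t u} → (∀ {a b} → a ∈ leaves t → b ∈ leaves u → ¬ (a ~ b) × a ≢ b) →
               parity (length (leaves t) * length (leaves u)) ≡ 0ℙ → Pair t u

  data Good : LTree A → Set where
    good-leaf : ∀ {x} → Good (leaf x)
    good-node : ∀ {ts} → All Good ts → AllPairs Pair ts → Good (node ts)

  pair-sym : Symmetric Pair
  pair-sym (siblings x~y) = siblings (~-sym x~y)
  pair-sym (apart {t} {u} h e) =
    apart (λ b∈ a∈ → let (¬a~b , a≢b) = h a∈ b∈ in ¬a~b ∘ ~-sym , a≢b ∘ sym)
          (trans (cong parity (*-comm (length (leaves u)) (length (leaves t)))) e)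

  allPairs-↭ : ∀ {ts us} → ts ↭ us → AllPairs Pair ts → AllPairs Pair us
  allPairs-↭ p = AllPairs-resp-↭ (setoid (LTree A)) pair-sym ((λ { refl q → q }) , (λ { refl q → q })) (↭⇒↭ₛ p)

  module Ranked (r : A → ℕ) (r-injective : ∀ {x y} → r x ≡ r y → x ≡ y) where

    inv : A → A → ℕ
    inv x y = if does (r y <? r x) then 1 else 0

    sib nonsib : A → A → ℕ
    sib x y    = if does (x ~? y) then inv x y else 0
    nonsib x y = if does (x ~? y) then 0 else inv x y

    inv-<⇒1 : ∀ {x y} → r y < r x → inv x y ≡ 1
    inv-<⇒1 {x} {y} lt = cong (if_then 1 else 0) (dec-true (r y <? r x) lt)

    inv-≮⇒0 : ∀ {x y} → ¬ (r y < r x) → inv x y ≡ 0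
    inv-≮⇒0 {x} {y} nlt = cong (if_then 1 else 0) (dec-false (r y <? r x) nlt)

    inv-mono : ∀ {w x y z} → (r x < r w → r z < r y) → inv w x ≤ inv y z
    inv-mono {w} {x} {y} {z} h with r x <? r w
    ... | yes lt = ≤-reflexive (trans (inv-<⇒1 lt) (sym (inv-<⇒1 (h lt))))
    ... | no nlt = ≤-trans (≤-reflexive (inv-≮⇒0 nlt)) z≤n

    inv-total : ∀ {x y} → x ≢ y → inv x y + inv y x ≡ 1
    inv-total {x} {y} x≢y with r y <? r x
    ... | yes lt = cong₂ _+_ (inv-<⇒1 lt) (inv-≮⇒0 (<-asym lt))
    ... | no nlt = cong₂ _+_ (inv-≮⇒0 nlt) (inv-<⇒1 (≤∧≢⇒< (≮⇒≥ nlt) (x≢y ∘ r-injective)))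

    sib-sep : ∀ {x y} → ¬ (x ~ y) → sib x y ≡ 0
    sib-sep {x} {y} n rewrite dec-false (x ~? y) n = refl

    nonsib-~ : ∀ {x y} → x ~ y → nonsib x y ≡ 0
    nonsib-~ {x} {y} s rewrite dec-true (x ~? y) s = refl

    nonsib-sep : ∀ {x y} → ¬ (x ~ y) → nonsib x y ≡ inv x y
    nonsib-sep {x} {y} n rewrite dec-false (x ~? y) n = refl

    inv-split : ∀ x y → inv x y ≡ sib x y + nonsib x y
    inv-split x y with x ~? y
    ... | yes _ = sym (+-identityʳ _)
    ... | no  _ = refl

    pairs-split : ∀ xs → pairs inv xs ≡ pairs sib xs + pairs nonsib xs
    pairs-split xs = trans (pairs-cong _ _ xs (λ {x} {y} _ _ → inv-split x y)) (pairs-+ sib nonsib xs)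

    cross-pair : ∀ {t u} → Pair t u → cross nonsib (leaves t) (leaves u) ≡₂ cross nonsib (leaves u) (leaves t)
    cross-pair (siblings {x} {y} x~y) = cong parity (cong (λ z → z + 0 + 0) (trans (nonsib-~ x~y) (sym (nonsib-~ (~-sym x~y)))))
    cross-pair (apart {t} {u} h e) = sum-even⇒≡₂ (cross nonsib (leaves t) (leaves u)) _
      (trans (cong parity (cross-sum nonsib (leaves t) (leaves u) λ a∈ b∈ →
        let (¬a~b , a≢b) = h a∈ b∈ in
        trans (cong₂ _+_ (nonsib-sep ¬a~b) (nonsib-sep (¬a~b ∘ ~-sym))) (inv-total a≢b))) e)

    -- A permutation of the children decomposes into adjacent swaps, and swapping `t` with `u`
    -- reverses only the cross term between these two blocks; `rest` is symmetric in them.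
    pairs-leavesF : ∀ {ts us} → AllPairs Pair ts → ts ↭ us →
                    pairs nonsib (leavesF ts) ≡₂ pairs nonsib (leavesF us)
    pairs-leavesF ps refl = refl
    pairs-leavesF {ts = t ∷ ts} {_ ∷ us} (_ ∷ ps) (prep t p) = begin
      parity (pairs nonsib (leaves t ++ leavesF ts))
        ≡⟨ cong parity (pairs-++ nonsib (leaves t) _) ⟩
      parity (pairs nonsib (leaves t) + pairs nonsib (leavesF ts) + cross nonsib (leaves t) (leavesF ts))
        ≡⟨ ≡₂-+ (pairs nonsib (leaves t) + pairs nonsib (leavesF ts)) (pairs nonsib (leaves t) + pairs nonsib (leavesF us))
             _ (cross nonsib (leaves t) (leavesF us))
             (≡₂-+ (pairs nonsib (leaves t)) (pairs nonsib (leaves t)) _ (pairs nonsib (leavesF us)) refl (pairs-leavesF ps p))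
             (cong parity (cross-↭ nonsib {leaves t} refl (leavesF-↭ p))) ⟩
      parity (pairs nonsib (leaves t) + pairs nonsib (leavesF us) + cross nonsib (leaves t) (leavesF us))
        ≡⟨ cong parity (pairs-++ nonsib (leaves t) _) ⟨
      parity (pairs nonsib (leaves t ++ leavesF us)) ∎
      where open ≡-Reasoning
    pairs-leavesF {ts = t ∷ u ∷ ts} {_ ∷ _ ∷ us} ((pr ∷ _) ∷ _ ∷ ps) (swap t u p) = begin
      parity (pairs nonsib (a ++ b ++ leavesF ts))
        ≡⟨ cong parity (expand a b (leavesF ts)) ⟩
      parity (cross nonsib a b + rest a b (leavesF ts))
        ≡⟨ ≡₂-+ (cross nonsib a b) (cross nonsib b a) (rest a b (leavesF ts)) (rest b a (leavesF us)) (cross-pair pr)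
             (trans (≡₂-+ (pairs nonsib (leavesF ts)) (pairs nonsib (leavesF us)) _ _ (pairs-leavesF ps p)
                (cong parity (cong₂ (λ y z → pairs nonsib a + pairs nonsib b + (y + z))
                  (cross-↭ nonsib {b} refl (leavesF-↭ p)) (cross-↭ nonsib {a} refl (leavesF-↭ p)))))
                (cong parity (rest-comm (leavesF us)))) ⟩
      parity (cross nonsib b a + rest b a (leavesF us))
        ≡⟨ cong parity (expand b a (leavesF us)) ⟨
      parity (pairs nonsib (b ++ a ++ leavesF us)) ∎
      where
      open ≡-Reasoning
      a = leaves t
      b = leaves u
      rest : List A → List A → List A → ℕ
      rest a b c = pairs nonsib c + (pairs nonsib a + pairs nonsib b + (cross nonsib b c + cross nonsib a c))
      rearrange : ∀ pa pb pc bc ab ac → pa + (pb + pc + bc) + (ab + ac) ≡ ab + (pc + (pa + pb + (bc + ac)))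
      rearrange = solve-∀
      expand : ∀ a b c → pairs nonsib (a ++ b ++ c) ≡ cross nonsib a b + rest a b c
      expand a b c = trans (pairs-++ nonsib a (b ++ c)) (trans
        (cong₂ (λ y z → pairs nonsib a + y + z) (pairs-++ nonsib b c) (cross-++ʳ nonsib a b c))
        (rearrange (pairs nonsib a) (pairs nonsib b) (pairs nonsib c) (cross nonsib b c) (cross nonsib a b) (cross nonsib a c)))
      rest-comm : ∀ c → rest a b c ≡ rest b a c
      rest-comm c = cong (pairs nonsib c +_) (cong₂ _+_ (+-comm (pairs nonsib a) _) (+-comm (cross nonsib b c) _))
    pairs-leavesF ps (↭trans p q) = trans (pairs-leavesF ps p) (pairs-leavesF (allPairs-↭ p ps) q)

    mutual
      -- Cross terms depend only on which leaves a child contains, so reordering inside the children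
      -- can be treated child by child.
      yields-parity : ∀ {T σ} → Good T → Yields T σ → pairs nonsib σ ≡₂ pairs nonsib (leaves T)
      yields-parity good-leaf y-leaf = refl
      yields-parity (good-node gs ps) (y-node p ys) =
        trans (yieldsF-parity (All-resp-↭ (↭-sym p) gs) ys) (pairs-leavesF (allPairs-↭ (↭-sym p) ps) p)

      yieldsF-parity : ∀ {ts σs} → All Good ts → Pointwise Yields ts σs →
                       pairs nonsib (concat σs) ≡₂ pairs nonsib (leavesF ts)
      yieldsF-parity [] [] = refl
      yieldsF-parity {t ∷ ts} {σ ∷ σs} (g ∷ gs) (y ∷ ys) = begin
        parity (pairs nonsib (σ ++ concat σs))
          ≡⟨ cong parity (pairs-++ nonsib σ _) ⟩
        parity (pairs nonsib σ + pairs nonsib (concat σs) + cross nonsib σ (concat σs))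
          ≡⟨ ≡₂-+ (pairs nonsib σ + pairs nonsib (concat σs)) (pairs nonsib (leaves t) + pairs nonsib (leavesF ts)) _ _
               (≡₂-+ (pairs nonsib σ) (pairs nonsib (leaves t)) (pairs nonsib (concat σs)) (pairs nonsib (leavesF ts))
                 (yields-parity g y) (yieldsF-parity gs ys))
               (cong parity (cross-↭ nonsib (yields-↭ y) (yieldsF-↭ ys))) ⟩
        parity (pairs nonsib (leaves t) + pairs nonsib (leavesF ts) + cross nonsib (leaves t) (leavesF ts))
          ≡⟨ cong parity (pairs-++ nonsib (leaves t) _) ⟨
        parity (pairs nonsib (leaves t ++ leavesF ts)) ∎
        where open ≡-Reasoning

    row-exchange : ∀ {x y} → r y ≤ r x → ∀ z β {γ} → row inv z (β ++ x ∷ γ) ≤ row inv z (β ++ y ∷ γ)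
    row-exchange le z []      = +-monoˡ-≤ _ (inv-mono (≤-<-trans le))
    row-exchange le z (b ∷ β) = +-monoʳ-≤ (inv z b) (row-exchange le z β)

    -- The inversion of `x` and `y` itself is saved. A letter `b` in between costs nothing:
    -- `r b < r y` implies `r b < r x`, and `r x < r b` implies `r y < r b`. Letters of `γ` see no
    -- change.
    pairs-exchange : ∀ {x y} → r y < r x → ∀ β γ → pairs inv (y ∷ β ++ x ∷ γ) < pairs inv (x ∷ β ++ y ∷ γ)
    pairs-exchange {x} {y} lt [] γ = begin-strict
      (inv y x + row inv y γ) + (row inv x γ + pairs inv γ)  ≡⟨ cong (λ i → (i + row inv y γ) + _) (inv-≮⇒0 (<-asym lt)) ⟩
      row inv y γ + (row inv x γ + pairs inv γ)              <⟨ n<1+n _ ⟩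
      suc (row inv y γ + (row inv x γ + pairs inv γ))        ≡⟨ cong suc (x∙yz≈y∙xz (row inv y γ) (row inv x γ) _) ⟩
      suc (row inv x γ + (row inv y γ + pairs inv γ))
        ≡⟨ cong (λ i → (i + row inv x γ) + (row inv y γ + pairs inv γ)) (inv-<⇒1 lt) ⟨
      (inv x y + row inv x γ) + (row inv y γ + pairs inv γ)  ∎
      where
      open ≤-Reasoning
    pairs-exchange {x} {y} lt (b ∷ β) γ = begin-strict
      -- Regrouping detaches `b`, and what remains is the same exchange across the shorter `β`.
      (inv y b + row inv y L) + (row inv b L + pairs inv L) ≡⟨ interchange (inv y b) (row inv y L) (row inv b L) _ ⟩
      (inv y b + row inv b L) + pairs inv (y ∷ L)
        <⟨ +-mono-≤-< (+-mono-≤ (inv-mono λ b<y → <-trans b<y lt) (row-exchange (<⇒≤ lt) b β)) (pairs-exchange lt β γ) ⟩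
      (inv x b + row inv b M) + pairs inv (x ∷ M)           ≡⟨ interchange (inv x b) (row inv x M) (row inv b M) _ ⟨
      (inv x b + row inv x M) + (row inv b M + pairs inv M) ∎
      where
      open ≤-Reasoning
      L = β ++ x ∷ γ
      M = β ++ y ∷ γ

    pairs-++-< : ∀ {α α′ β β′} → α ↭ α′ → β ↭ β′ → pairs inv α + pairs inv β < pairs inv α′ + pairs inv β′ →
                 pairs inv (α ++ β) < pairs inv (α′ ++ β′)
    pairs-++-< {α} {α′} {β} {β′} p q lt = subst₂ _<_ (sym (pairs-++ inv α β)) (sym (pairs-++ inv α′ β′))
      (+-mono-<-≤ lt (≤-reflexive (cross-↭ inv p q)))

    -- The permutation is carried along because improving one block must leave its cross terms with
    -- the other blocks intact.
    Better : LTree A → List A → Set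
    Better T σ = ∃[ σ′ ] Yields T σ′ × σ′ ↭ σ × pairs inv σ′ < pairs inv σ

    BetterF : List (LTree A) → List A → Set
    BetterF ts τ = ∃₂ λ us σs → us ↭ ts × Pointwise Yields us σs × concat σs ↭ τ × pairs inv (concat σs) < pairs inv τ

    -- Replacing the child `leaf y` by `leaf x` is expressed by `permuted`, without naming a
    -- position among the children; `old` and `new` say that `x` takes the place of `y` in the word.
    record Exchange (x : A) (ts : List (LTree A)) (τ : List A) : Set where
      constructor exchange
      field
        {y}        : A
        β γ        : List A
        {us}       : List (LTree A)
        {σs}       : List (List A)
        old        : τ ≡ β ++ y ∷ γ
        new        : concat σs ≡ β ++ x ∷ γ
        yields     : Pointwise Yields us σs
        permuted   : leaf y ∷ us ↭ leaf x ∷ ts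
        inverted   : r y < r x

    exchange-∷ : ∀ {x t ts σ τ} → Yields t σ → Exchange x ts τ → Exchange x (t ∷ ts) (σ ++ τ)
    exchange-∷ {σ = σ} y (exchange β γ refl new ys p lt) =
      exchange (σ ++ β) γ (sym (++-assoc σ β _)) (trans (cong (σ ++_) new) (sym (++-assoc σ β _))) (y ∷ ys)
        (↭trans (swap _ _ refl) (↭trans (prep _ p) (swap _ _ refl))) lt

    findExchange : ∀ {x ts σs} → All (Pair (leaf x)) ts → Pointwise Yields ts σs →
                   row sib x (concat σs) ≡ 0 ⊎ Exchange x ts (concat σs)
    findExchange [] [] = inj₁ refl
    findExchange {x} {t ∷ _} {σ ∷ σs} (p ∷ ps) (y ∷ ys) with findExchange ps ys
    ... | inj₂ e = inj₂ (exchange-∷ y e)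
    ... | inj₁ e with p | y
    ...   | apart h _ | _ = inj₁ (trans (row-++ sib x σ _)
            (cong₂ _+_ (row-zero sib x σ λ b∈ → sib-sep (proj₁ (h (here refl) (∈-resp-↭ (yields-↭ y) b∈)))) e))
    ...   | siblings {y = z} x~z | y-leaf with r z <? r x
    ...     | yes lt = inj₂ (exchange [] (concat σs) refl refl (y-leaf ∷ ys) (swap _ _ refl) lt)
    ...     | no nlt = inj₁ (cong₂ _+_ sib≡0 e)
      where
      sib≡0 : sib x z ≡ 0
      sib≡0 rewrite dec-true (x ~? z) x~z = inv-≮⇒0 nlt

    cross-sib-node : ∀ {us ts} → All (Pair (node us)) ts → cross sib (leavesF us) (leavesF ts) ≡ 0
    cross-sib-node {us} [] = cross-zero sib (leavesF us) [] λ _ ()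
    cross-sib-node {us} {t ∷ ts} (apart h _ ∷ ps) = trans (cross-++ʳ sib (leavesF us) (leaves t) _)
      (cong₂ _+_ (cross-zero sib (leavesF us) (leaves t) λ a∈ b∈ → sib-sep (proj₁ (h a∈ b∈))) (cross-sib-node ps))

    betterCross : ∀ {t ts σ σs} → All (Pair t) ts → Yields t σ → Pointwise Yields ts σs →
                  cross sib σ (concat σs) ≡ 0 ⊎ BetterF (t ∷ ts) (σ ++ concat σs)
    betterCross {node us} ps y ys = inj₁ (trans (cross-↭ sib (yields-↭ y) (yieldsF-↭ ys)) (cross-sib-node ps))
    betterCross {leaf x} ps y-leaf ys with findExchange ps ys
    ... | inj₁ e = inj₁ (trans (+-identityʳ _) e)
    ... | inj₂ (exchange {y} β γ {us} {σs} old new ys′ p lt) rewrite old =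
      inj₂ (leaf y ∷ us , (y ∷ []) ∷ σs , p , y-leaf ∷ ys′
           , subst (λ τ → y ∷ τ ↭ x ∷ β ++ y ∷ γ) (sym new)
               (↭trans (prep y (shift x β γ)) (↭trans (swap y x refl) (prep x (↭-sym (shift y β γ)))))
           , subst (λ τ → pairs inv (y ∷ τ) < _) (sym new) (pairs-exchange lt β γ))

    mutual
      -- Sibling inversions lie either inside one child or between two leaf children of the same
      -- node. In the latter case the two leaves trade places, which is again an ordering of the
      -- tree and has strictly fewer inversions.
      improve : ∀ {T σ} → Good T → Yields T σ → pairs sib σ ≡ 0 ⊎ Better T σ
      improve good-leaf y-leaf = inj₁ refl
      improve (good-node gs ps) (y-node p ys)
        with improveF (All-resp-↭ (↭-sym p) gs) (allPairs-↭ (↭-sym p) ps) ys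
      ... | inj₁ e = inj₁ e
      ... | inj₂ (us , σs , q , ys′ , c , lt) = inj₂ (concat σs , y-node (↭trans q p) ys′ , c , lt)

      improveF : ∀ {ts σs} → All Good ts → AllPairs Pair ts → Pointwise Yields ts σs →
                 pairs sib (concat σs) ≡ 0 ⊎ BetterF ts (concat σs)
      improveF [] [] [] = inj₁ refl
      improveF {t ∷ ts} {σ ∷ σs} (g ∷ gs) (p ∷ ps) (y ∷ ys)
        with improveF gs ps ys | improve g y | betterCross p y ys
      ... | inj₂ (us , τs , q , ys′ , c , lt) | _ | _ =
        inj₂ (t ∷ us , σ ∷ τs , prep t q , y ∷ ys′ , ++⁺ˡ σ c , pairs-++-< {σ} refl c (+-monoʳ-< (pairs inv σ) lt))
      ... | inj₁ _ | inj₂ (τ , y′ , c , lt) | _ =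
        inj₂ (t ∷ ts , τ ∷ σs , refl , y′ ∷ ys , ++⁺ʳ (concat σs) c , pairs-++-< c refl (+-monoˡ-< _ lt))
      ... | inj₁ _ | inj₁ _ | inj₂ b = inj₂ b
      ... | inj₁ e₁ | inj₁ e₂ | inj₁ e₃ =
        inj₁ (trans (pairs-++ sib σ _) (cong₂ _+_ (cong₂ _+_ e₂ e₁) e₃))

    -- An optimal ordering has no sibling inversions, and the parity of the others can be read off
    -- the fixed list `leaves T`. The ordering disappears from the statement, so different rankings
    -- can be compared on one and the same list.
    minimum-parity : ∀ {T m} → Good T → (∃[ σ ] Yields T σ × pairs inv σ ≡ m) →
                     (∀ σ → Yields T σ → m ≤ pairs inv σ) → m ≡₂ pairs nonsib (leaves T)
    minimum-parity g (σ , y , refl) least with improve g y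
    ... | inj₂ (τ , y′ , _ , lt) = ⊥-elim (<⇒≱ lt (least τ y′))
    ... | inj₁ e = trans (cong parity (trans (pairs-split σ) (cong (_+ pairs nonsib σ) e))) (yields-parity g y)

  module _ (r r′ : A → ℕ) (r-inj : ∀ {x y} → r x ≡ r y → x ≡ y) (r′-inj : ∀ {x y} → r′ x ≡ r′ y → x ≡ y) where
    private
      module R  = Ranked r r-inj
      module R′ = Ranked r′ r′-inj

    nonsib-flip : ∀ {x y xs} → x ≢ y → ¬ (x ~ y) →
      (∀ {a b} → (a , b) ≢ (x , y) → (a , b) ≢ (y , x) → R.inv a b ≡ R′.inv a b) →
      R.inv x y ≡₂ suc (R′.inv x y) → R.inv y x ≡₂ suc (R′.inv y x) →
      AllPairs _≢_ xs → x ∈ xs → y ∈ xs → pairs R.nonsib xs ≡₂ suc (pairs R′.nonsib xs)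
    nonsib-flip {x} {y} x≢y x≁y agree xy yx = pairs-flip R.nonsib R′.nonsib x≢y
      (λ {a} {b} n₁ n₂ → cong (if does (a ~? b) then 0 else_) (agree n₁ n₂))
      (subst₂ (λ i j → i ≡₂ suc j) (sym (R.nonsib-sep x≁y)) (sym (R′.nonsib-sep x≁y)) xy)
      (subst₂ (λ i j → i ≡₂ suc j) (sym (R.nonsib-sep (x≁y ∘ ~-sym))) (sym (R′.nonsib-sep (x≁y ∘ ~-sym))) yx)

-- Leaf child sets

odds : List ℕ → ℕ
odds ms = length (filter (λ m → m % 2 ℕ.≟ 1) ms)

odds-++ : ∀ ms ns → odds (ms ++ ns) ≡ odds ms + odds ns
odds-++ ms ns = trans (cong length (filter-++ (λ m → m % 2 ℕ.≟ 1) ms ns)) (length-++ (filter (λ m → m % 2 ℕ.≟ 1) ms))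

0<odds : ∀ {ms} → Any (λ m → m % 2 ≡ 1) ms → 0 < odds ms
0<odds = filter-some (λ m → m % 2 ℕ.≟ 1)

not-odd : ∀ m → ¬ (m % 2 ≡ 1) → parity m ≡ 0ℙ
not-odd zero          _ = refl
not-odd (suc zero)    h = ⊥-elim (h refl)
not-odd (suc (suc m)) h = not-odd m h

module _ {A : Set} where

  unique-↭ : {xs ys : List A} → xs ↭ ys → Unique xs → Unique ys
  unique-↭ p = ↭ₛ.Unique-resp-↭ (setoid A) (↭⇒↭ₛ p)

  unique-++⁻ : ∀ (xs : List A) {ys} → Unique (xs ++ ys) →
               Unique xs × Unique ys × (∀ {x} → x ∈ xs → x ∈ ys → ⊥)
  unique-++⁻ []       u = [] , u , λ ()
  unique-++⁻ (x ∷ xs) (x∉ ∷ u) with unique-++⁻ xs u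
  ... | u₁ , u₂ , d = All.++⁻ˡ xs x∉ ∷ u₁ , u₂ ,
    λ { (here refl) y∈ → All.lookup (All.++⁻ʳ xs x∉) y∈ refl ; (there x∈) y∈ → d x∈ y∈ }

  unique-concat : ∀ {gs : List (List A)} {g h x} → Unique (concat gs) →
                  g ∈ gs → h ∈ gs → x ∈ g → x ∈ h → g ≡ h
  unique-concat u (here refl) (here refl) x∈g x∈h = refl
  unique-concat {g ∷ _} u (here refl) (there h∈) x∈g x∈h =
    ⊥-elim (proj₂ (proj₂ (unique-++⁻ g u)) x∈g (∈-concat⁺′ x∈h h∈))
  unique-concat {g ∷ _} u (there g∈) (here refl) x∈g x∈h =
    ⊥-elim (proj₂ (proj₂ (unique-++⁻ g u)) x∈h (∈-concat⁺′ x∈g g∈))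
  unique-concat {g ∷ _} u (there g∈) (there h∈) = unique-concat (proj₁ (proj₂ (unique-++⁻ g u))) g∈ h∈

  leafLabels : List (LTree A) → List A
  leafLabels []            = []
  leafLabels (leaf x ∷ ts) = x ∷ leafLabels ts
  leafLabels (node _ ∷ ts) = leafLabels ts

  mutual
    leafChildSets : LTree A → List (List A)
    leafChildSets (leaf _)  = []
    leafChildSets (node ts) = leafLabels ts ∷ leafChildSetsF ts

    leafChildSetsF : List (LTree A) → List (List A)
    leafChildSetsF []       = []
    leafChildSetsF (t ∷ ts) = leafChildSets t ++ leafChildSetsF ts

  length-leafLabels : ∀ ts → length (leafLabels ts) ≡ leafChildCount ts
  length-leafLabels []            = refl
  length-leafLabels (leaf _ ∷ ts) = cong suc (length-leafLabels ts)
  length-leafLabels (node _ ∷ ts) = length-leafLabels ts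

  mutual
    length-leafChildSets : ∀ T → map length (leafChildSets T) ≡ lcsList T
    length-leafChildSets (leaf _)  = refl
    length-leafChildSets (node ts) = cong₂ _∷_ (length-leafLabels ts) (length-leafChildSetsF ts)

    length-leafChildSetsF : ∀ ts → map length (leafChildSetsF ts) ≡ lcsListF ts
    length-leafChildSetsF []       = refl
    length-leafChildSetsF (t ∷ ts) = trans (map-++ length (leafChildSets t) _)
      (cong₂ _++_ (length-leafChildSets t) (length-leafChildSetsF ts))

  -- Each leaf of a forest is either one of its roots, hence in the leaf child set of the node
  -- above, or in a leaf child set further down. This makes leaf child sets disjoint and reduces
  -- leaf counts to their sizes.
  concat-leafChildSetsF : ∀ ts → leafLabels ts ++ concat (leafChildSetsF ts) ↭ leavesF ts
  concat-leafChildSetsF []             = refl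
  concat-leafChildSetsF (leaf x ∷ ts)  = prep x (concat-leafChildSetsF ts)
  concat-leafChildSetsF (node us ∷ ts) = ↭trans
    (++⁺ˡ (leafLabels ts) (↭-reflexive (sym (concat-++ (leafLabels us ∷ leafChildSetsF us) (leafChildSetsF ts)))))
    (↭trans (shifts (leafLabels ts) (concat (leafLabels us ∷ leafChildSetsF us)))
      (++⁺ (concat-leafChildSetsF us) (concat-leafChildSetsF ts)))

  even-concat : ∀ (gs : List (List A)) → ¬ Any (λ m → m % 2 ≡ 1) (map length gs) → parity (length (concat gs)) ≡ 0ℙ
  even-concat []       h = refl
  even-concat (g ∷ gs) h = trans (cong parity (length-++ g)) (trans (+-homo-+ (length g) _)
    (cong₂ ℙ._+_ (not-odd (length g) (h ∘ here)) (even-concat gs (h ∘ there))))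

  -- The leaf child sets partition the leaves below a node. This fails for a bare leaf, which has no
  -- leaf child set but an odd number of leaves; hence the separate treatment of leaves in `pair`.
  even-leaves : ∀ us → ¬ HasOdd (node us) → parity (length (leavesF us)) ≡ 0ℙ
  even-leaves us h = trans (cong parity (sym (↭-length (concat-leafChildSetsF us))))
    (even-concat (leafChildSets (node us)) (h ∘ subst (Any _) (length-leafChildSets (node us))))

  leaves-⊆ : ∀ {t x} {ts : List (LTree A)} → t ∈ ts → x ∈ leaves t → x ∈ leavesF ts
  leaves-⊆ (here refl) x∈ = ∈-++⁺ˡ x∈
  leaves-⊆ {ts = u ∷ _} (there t∈) x∈ = ∈-++⁺ʳ (leaves u) (leaves-⊆ t∈ x∈)

  leafChildSets-⊆ : ∀ {t g} {ts : List (LTree A)} → t ∈ ts → g ∈ leafChildSets t → g ∈ leafChildSetsF ts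
  leafChildSets-⊆ (here refl) g∈ = ∈-++⁺ˡ g∈
  leafChildSets-⊆ {ts = u ∷ _} (there t∈) g∈ = ∈-++⁺ʳ (leafChildSets u) (leafChildSets-⊆ t∈ g∈)

  leafLabels-∈ : ∀ {x} {ts : List (LTree A)} → leaf x ∈ ts → x ∈ leafLabels ts
  leafLabels-∈ (here refl) = here refl
  leafLabels-∈ {ts = leaf _ ∷ _} (there x∈) = there (leafLabels-∈ x∈)
  leafLabels-∈ {ts = node _ ∷ _} (there x∈) = leafLabels-∈ x∈

  leafChildCount≢0 : ∀ {x} {ts : List (LTree A)} → leaf x ∈ ts → leafChildCount ts ≢ 0
  leafChildCount≢0 {ts = ts} x∈ e with leafLabels ts | leafLabels-∈ x∈ | trans (length-leafLabels ts) e
  ... | _ ∷ _ | _ | ()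

  odds-any : ∀ {ts : List (LTree A)} → Any HasOdd ts → 0 < odds (lcsListF ts)
  odds-any {t ∷ ts} o rewrite odds-++ (lcsList t) (lcsListF ts) with o
  ... | here o′  = <-≤-trans (0<odds o′) (m≤m+n _ _)
  ... | there o′ = <-≤-trans (odds-any o′) (m≤n+m _ (odds (lcsList t)))

-- Deriving the parity conditions from the hypotheses on the tree

module FromTree {A : Set} (_≟A_ : DecidableEquality A) (T : LTree A) (uniq : Unique (leaves T)) where

  infix 4 _~_ _~?_
  -- Every label in a leaf child set is related to itself, which is what allows transitivity without
  -- exceptions.
  _~_ : A → A → Set
  x ~ y = Any (λ g → x ∈ g × y ∈ g) (leafChildSets T)

  open import Data.List.Membership.DecPropositional _≟A_ using (_∈?_)

  _~?_ : Decidable _~_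
  x ~? y = Any.any? (λ g → (x ∈? g) ×-dec (y ∈? g)) (leafChildSets T)

  ~-sym : Symmetric _~_
  ~-sym = Any.map λ { (x∈ , y∈) → y∈ , x∈ }

  unique-sets : Unique (concat (leafChildSets T))
  unique-sets = go T uniq
    where
    go : ∀ T → Unique (leaves T) → Unique (concat (leafChildSets T))
    go (leaf _)  u = []
    go (node ts) u = unique-↭ (↭-sym (concat-leafChildSetsF ts)) u

  ~-closed : ∀ {g x y} → g ∈ leafChildSets T → x ∈ g → x ~ y → y ∈ g
  ~-closed g∈ x∈ x~y with find x~y
  ... | h , h∈ , x∈h , y∈h = subst (_ ∈_) (unique-concat unique-sets h∈ g∈ x∈h x∈) y∈h

  ~-trans : Transitive _~_
  ~-trans x~y y~z with find x~y
  ... | g , g∈ , x∈ , y∈ = lose g∈ (x∈ , ~-closed g∈ y∈ y~z)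

  ~-bounded : ∀ {k} → All (_≤ k) (lcsList T) → ∀ x → Σ[ g ∈ List A ] length g ≤ k × (∀ {y} → x ~ y → y ∈ g)
  ~-bounded {k} bound x with Any.any? (x ∈?_) (leafChildSets T)
  ... | no n = [] , z≤n , λ x~y → ⊥-elim (n (Any.map proj₁ x~y))
  ... | yes p with find p
  ...   | g , g∈ , x∈ = g , All.lookup (All.map⁻ (subst (All (_≤ k)) (sym (length-leafChildSets T)) bound)) g∈ , ~-closed g∈ x∈

  open Siblings {_~_ = _~_} ~-sym _~?_

  node-closed : ∀ us {a b} → (∀ {g} → g ∈ leafChildSets (node us) → g ∈ leafChildSets T) →
                a ∈ leavesF us → a ~ b → b ∈ leavesF us
  node-closed us sub a∈ a~b with ∈-concat⁻′ (leafChildSets (node us)) (∈-resp-↭ (↭-sym (concat-leafChildSetsF us)) a∈)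
  ... | g , a∈g , g∈ = ∈-resp-↭ (concat-leafChildSetsF us) (∈-concat⁺′ (~-closed (sub g∈) a∈g a~b) g∈)

  even-*ˡ : ∀ m n → parity m ≡ 0ℙ → parity (m * n) ≡ 0ℙ
  even-*ˡ m n e rewrite *-homo-* m n | e = refl

  even-*ʳ : ∀ m n → parity n ≡ 0ℙ → parity (m * n) ≡ 0ℙ
  even-*ʳ m n e = trans (cong parity (*-comm m n)) (even-*ˡ n m e)

  -- A node with a leaf child has no odd leaf child set below it, so a leaf beside an internal node
  -- meets an even leaf count. Of two internal nodes at most one contains the odd set, so the other
  -- supplies the even factor.
  pair : ∀ t u → (∀ {g} → g ∈ leafChildSets t → g ∈ leafChildSets T) → (∀ {g} → g ∈ leafChildSets u → g ∈ leafChildSets T) →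
         (∀ {x y} → t ≡ leaf x → u ≡ leaf y → x ~ y) →
         (∀ {x} → x ∈ leaves t → x ∈ leaves u → ⊥) →
         (HasOdd t → HasOdd u → ⊥) → (∀ {x} → t ≡ leaf x → ¬ HasOdd u) → (∀ {x} → u ≡ leaf x → ¬ HasOdd t) → Pair t u
  pair (leaf x) (leaf y) _ _ s _ _ _ _ = siblings (s refl refl)
  pair (leaf x) (node us) _ subu _ dis _ e _ =
    apart (λ a∈ b∈ → (λ a~b → dis a∈ (node-closed us subu b∈ (~-sym a~b))) , λ { refl → dis a∈ b∈ })
      (even-*ʳ 1 (length (leavesF us)) (even-leaves us (e refl)))
  pair (node ts) (leaf y) subt _ _ dis _ _ e =
    apart (λ a∈ b∈ → (λ a~b → dis (node-closed ts subt a∈ a~b) b∈) , λ { refl → dis a∈ b∈ })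
      (even-*ˡ (length (leavesF ts)) 1 (even-leaves ts (e refl)))
  pair (node ts) (node us) subt _ _ dis o _ _ =
    apart (λ a∈ b∈ → (λ a~b → dis (node-closed ts subt a∈ a~b) b∈) , λ { refl → dis a∈ b∈ }) even
    where
    even : parity (length (leavesF ts) * length (leavesF us)) ≡ 0ℙ
    even with Any.any? (λ m → m % 2 ℕ.≟ 1) (lcsList (node ts))
    ... | yes ot = even-*ʳ (length (leavesF ts)) (length (leavesF us)) (even-leaves us (o ot))
    ... | no ¬ot = even-*ˡ (length (leavesF ts)) (length (leavesF us)) (even-leaves ts ¬ot)

  mutual
    -- Since `_~_` refers to the leaf child sets of the whole `T`, the induction carries along the
    -- inclusion of those of the subtree.
    good : ∀ t → (∀ {g} → g ∈ leafChildSets t → g ∈ leafChildSets T) → Unique (leaves t) →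
           oddCount t ≤ 1 → AncestorsEmpty t → Good t
    good (leaf _)  _ _ _ _ = good-leaf
    good (node ts) sub u o (ae-node as ae) =
      let gs , ps = goodF ts (sub ∘ there) (λ x∈ y∈ → lose (sub (here refl)) (leafLabels-∈ x∈ , leafLabels-∈ y∈)) u
                      (≤-trans (odds-tail (leafChildCount ts) (lcsListF ts)) o) as ae
      in good-node gs ps
      where
      odds-tail : ∀ m ms → odds ms ≤ odds (m ∷ ms)
      odds-tail m ms = ≤-trans (m≤n+m _ (odds (m ∷ []))) (≤-reflexive (sym (odds-++ (m ∷ []) ms)))

    goodF : ∀ ts → (∀ {g} → g ∈ leafChildSetsF ts → g ∈ leafChildSets T) →
            (∀ {x y} → leaf x ∈ ts → leaf y ∈ ts → x ~ y) → Unique (leavesF ts) →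
            odds (lcsListF ts) ≤ 1 → All AncestorsEmpty ts →
            (Any HasOdd ts → leafChildCount ts ≡ 0) → All Good ts × AllPairs Pair ts
    goodF [] _ _ _ _ _ _ = [] , []
    goodF (t ∷ ts) sub sib u o (a ∷ as) ae with unique-++⁻ (leaves t) u
    ... | u₁ , u₂ , dis =
      let o′ = subst (_≤ 1) (odds-++ (lcsList t) (lcsListF ts)) o
          gs , ps = goodF ts (sub ∘ ∈-++⁺ʳ (leafChildSets t)) (λ x∈ y∈ → sib (there x∈) (there y∈)) u₂
                      (m+n≤o⇒n≤o (odds (lcsList t)) o′) as
                      (λ any → m+n≡0⇒n≡0 (if isLeaf t then 1 else 0) (ae (there any)))
      in good t (sub ∘ ∈-++⁺ˡ) u₁ (m+n≤o⇒m≤o _ o′) a ∷ gs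
       , All.tabulate (λ {u} u∈ → pair t u (sub ∘ ∈-++⁺ˡ) (sub ∘ ∈-++⁺ʳ (leafChildSets t) ∘ leafChildSets-⊆ u∈)
           (λ { refl refl → sib (here refl) (there u∈) })
           (λ x∈t x∈u → dis x∈t (leaves-⊆ u∈ x∈u))
           (λ ot ou → <⇒≱ (+-mono-≤ (0<odds ot) (odds-any (lose u∈ ou))) o′)
           (λ { refl ou → leafChildCount≢0 {ts = t ∷ ts} (here refl) (ae (there (lose u∈ ou))) })
           (λ { refl ot → leafChildCount≢0 {ts = t ∷ ts} (there u∈) (ae (here ot)) })) ∷ ps

  tree-good : oddCount T ≤ 1 → AncestorsEmpty T → Good T
  tree-good = good T (λ g∈ → g∈) uniq

-- Rankings as words, and consecutive siblings

unique-⊆-length : {A : Set} {xs ys : List A} → Unique xs → (∀ {x} → x ∈ xs → x ∈ ys) → length xs ≤ length ys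
unique-⊆-length {xs = []} _ _ = z≤n
unique-⊆-length {xs = x ∷ xs} {ys} (x∉ ∷ u) sub with ∈-∃++ (sub (here refl))
... | as , bs , refl = ≤-trans (s≤s (unique-⊆-length u sub′)) (≤-reflexive (sym (↭-length (shift x as bs))))
  where
  sub′ : ∀ {y} → y ∈ xs → y ∈ as ++ bs
  sub′ y∈ with ∈-resp-↭ (shift x as bs) (sub (there y∈))
  ... | here refl = ⊥-elim (All.lookup x∉ y∈ refl)
  ... | there y∈′ = y∈′

-- An entry that is filtered out is at least `1 + 4 * k`, so `(1 + 2 * k) * length xs` is at most
-- `1 + 4 * k` times the number kept. Rounding this factor up to `2 + 4 * k` allows `1 + 2 * k` to
-- be cancelled, also when `k` is zero.
markov : {A : Set} (f : A → ℕ) (k : ℕ) (xs : List A) → sum (map f xs) ≤ 2 * k * length xs →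
         length xs ≤ 2 * length (filter (λ x → f x ≤? 4 * k) xs)
markov {A} f k xs h = *-cancelˡ-≤ (1 + 2 * k) (+-cancelʳ-≤ (2 * k * length xs) _ _ (begin
  (1 + 2 * k) * length xs + 2 * k * length xs                  ≡⟨ lem₁ k (length xs) ⟩
  (1 + 4 * k) * length xs                                      ≤⟨ bound xs ⟩
  sum (map f xs) + (1 + 4 * k) * small xs                      ≤⟨ +-mono-≤ h (*-monoˡ-≤ (small xs) (n≤1+n (1 + 4 * k))) ⟩
  2 * k * length xs + (2 + 4 * k) * small xs                   ≡⟨ lem₂ k (length xs) (small xs) ⟩
  (1 + 2 * k) * (2 * small xs) + 2 * k * length xs             ∎))
  where
  open ≤-Reasoning
  small : List A → ℕ
  small xs = length (filter (λ x → f x ≤? 4 * k) xs)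
  lem₁ : ∀ k l → (1 + 2 * k) * l + 2 * k * l ≡ (1 + 4 * k) * l
  lem₁ = solve-∀
  lem₂ : ∀ k l s → 2 * k * l + (2 + 4 * k) * s ≡ (1 + 2 * k) * (2 * s) + 2 * k * l
  lem₂ = solve-∀
  lem₃ : ∀ c s m → c + (s + c * m) ≡ s + c * suc m
  lem₃ = solve-∀
  bound : ∀ xs → (1 + 4 * k) * length xs ≤ sum (map f xs) + (1 + 4 * k) * small xs
  bound [] = ≤-refl
  bound (x ∷ xs) with f x ≤? 4 * k
  ... | yes p rewrite filter-accept (λ x → f x ≤? 4 * k) {x} {xs} p = begin
    (1 + 4 * k) * suc (length xs)                                       ≡⟨ *-suc (1 + 4 * k) (length xs) ⟩
    (1 + 4 * k) + (1 + 4 * k) * length xs                               ≤⟨ +-monoʳ-≤ (1 + 4 * k) (bound xs) ⟩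
    (1 + 4 * k) + (sum (map f xs) + (1 + 4 * k) * small xs)             ≡⟨ lem₃ (1 + 4 * k) (sum (map f xs)) (small xs) ⟩
    sum (map f xs) + (1 + 4 * k) * suc (small xs)                       ≤⟨ +-monoˡ-≤ _ (m≤n+m _ (f x)) ⟩
    (f x + sum (map f xs)) + (1 + 4 * k) * suc (small xs)               ∎
  ... | no ¬p rewrite filter-reject (λ x → f x ≤? 4 * k) {x} {xs} ¬p = begin
    (1 + 4 * k) * suc (length xs)                                       ≡⟨ *-suc (1 + 4 * k) (length xs) ⟩
    (1 + 4 * k) + (1 + 4 * k) * length xs                               ≤⟨ +-mono-≤ (≰⇒> ¬p) (bound xs) ⟩
    f x + (sum (map f xs) + (1 + 4 * k) * small xs)                     ≡⟨ +-assoc (f x) _ _ ⟨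
    (f x + sum (map f xs)) + (1 + 4 * k) * small xs                     ∎

-- Enumeration of rankings as words, and the comparisons that a word answers

module _ {A : Set} where

  inserts : A → List A → List (List A)
  inserts x []       = (x ∷ []) ∷ []
  inserts x (y ∷ ys) = (x ∷ y ∷ ys) ∷ map (y ∷_) (inserts x ys)

  perms : List A → List (List A)
  perms []       = [] ∷ []
  perms (x ∷ xs) = concatMap (inserts x) (perms xs)

  inserts-↭ : ∀ {x xs ys} → ys ∈ inserts x xs → ys ↭ x ∷ xs
  inserts-↭ {xs = []}    (here refl) = refl
  inserts-↭ {xs = _ ∷ _} (here refl) = refl
  inserts-↭ {xs = y ∷ _} (there m) with ∈-map⁻ (y ∷_) m
  ... | _ , m′ , refl = ↭trans (prep y (inserts-↭ m′)) (swap y _ refl)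

  length-inserts : ∀ x xs → length (inserts x xs) ≡ suc (length xs)
  length-inserts x []       = refl
  length-inserts x (y ∷ ys) = cong suc (trans (length-map (y ∷_) (inserts x ys)) (length-inserts x ys))

  inserts-unique : ∀ {x xs} → x ∉ xs → Unique (inserts x xs)
  inserts-unique {xs = []} _ = [] ∷ []
  inserts-unique {xs = y ∷ ys} x∉ =
    All.map⁺ (All.tabulate λ _ e → x∉ (here (∷-injectiveˡ e))) ∷ Unique.map⁺ ∷-injectiveʳ (inserts-unique (x∉ ∘ there))

  perms-↭ : ∀ xs {ys} → ys ∈ perms xs → ys ↭ xs
  perms-↭ [] (here refl) = refl
  perms-↭ (x ∷ xs) m with ∈-concat⁻′ (map (inserts x) (perms xs)) m
  ... | _ , m₁ , m₂ with ∈-map⁻ (inserts x) m₂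
  ...   | zs , z∈ , refl = ↭trans (inserts-↭ m₁) (prep x (perms-↭ xs z∈))

  length-perms : ∀ xs → length (perms xs) ≡ length xs !
  length-perms [] = refl
  length-perms (x ∷ xs) = trans (go (perms xs) (λ m → ↭-length (perms-↭ xs m)))
    (trans (*-comm (length (perms xs)) _) (cong (suc (length xs) *_) (length-perms xs)))
    where
    go : ∀ Ls → (∀ {ys} → ys ∈ Ls → length ys ≡ length xs) → length (concatMap (inserts x) Ls) ≡ length Ls * suc (length xs)
    go [] h = refl
    go (ys ∷ Ls) h = trans (length-++ (inserts x ys))
      (cong₂ _+_ (trans (length-inserts x ys) (cong suc (h (here refl)))) (go Ls (h ∘ there)))

  module _ (_≟_ : DecidableEquality A) where

    without : A → List A → List A
    without x = filter (λ y → ¬? (x ≟ y))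

    -- Erasing `x` recovers the word into which it was inserted, so insertions into different words
    -- never coincide; this gives `perms-unique`.
    without-inserts : ∀ {x xs ys} → x ∉ xs → ys ∈ inserts x xs → without x ys ≡ xs
    without-inserts {x} {xs} x∉ m = go xs x∉ m
      where
      skip : ∀ {ys} → without x (x ∷ ys) ≡ without x ys
      skip = filter-reject (λ y → ¬? (x ≟ y)) λ n → n refl
      keep : ∀ {ys} → x ∉ ys → without x ys ≡ ys
      keep n = filter-all (λ y → ¬? (x ≟ y)) (¬Any⇒All¬ _ n)
      go : ∀ xs {ys} → x ∉ xs → ys ∈ inserts x xs → without x ys ≡ xs
      go []       n (here refl) = skip
      go (y ∷ ys) n (here refl) = trans skip (keep n)
      go (y ∷ ys) n (there m) with ∈-map⁻ (y ∷_) m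
      ... | zs , m′ , refl = trans (filter-accept (λ y → ¬? (x ≟ y)) (n ∘ here)) (cong (y ∷_) (go ys (n ∘ there) m′))

    perms-unique : ∀ {xs} → Unique xs → Unique (perms xs)
    perms-unique [] = [] ∷ []
    perms-unique {x ∷ xs} (x∉ ∷ u) = go (perms xs) (λ m y∈ → All.lookup x∉ (∈-resp-↭ (perms-↭ xs m) y∈) refl) (perms-unique u)
      where
      go : ∀ Ls → (∀ {ys} → ys ∈ Ls → x ∉ ys) → Unique Ls → Unique (concatMap (inserts x) Ls)
      go [] h u = []
      go (ys ∷ Ls) h (y∉ ∷ u) = Unique.++⁺ (inserts-unique (h (here refl))) (go Ls (h ∘ there) u) λ { (m , m′) → disjoint m m′ }
        where
        disjoint : ∀ {zs} → zs ∈ inserts x ys → zs ∈ concatMap (inserts x) Ls → ⊥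
        disjoint m m′ with ∈-concat⁻′ (map (inserts x) Ls) m′
        ... | _ , m₁ , m₂ with ∈-map⁻ (inserts x) m₂
        ...   | ws , w∈ , refl =
          All.lookup y∉ w∈ (trans (sym (without-inserts (h (here refl)) m)) (without-inserts (h (there w∈)) m₁))

    -- Testing for `j` first makes `before L i i` false, in agreement with the strict comparison of
    -- positions.
    before : List A → A → A → Bool
    before []       i j = false
    before (h ∷ hs) i j = if does (h ≟ j) then false else if does (h ≟ i) then true else before hs i j

    position : List A → A → ℕ
    position []       i = 0
    position (h ∷ hs) i = if does (h ≟ i) then 0 else suc (position hs i)

    position-before : ∀ L i j → does (position L i <? position L j) ≡ before L i j
    position-before [] i j = refl
    position-before (h ∷ hs) i j with does (h ≟ j) | does (h ≟ i)
    ... | true  | true  = refl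
    ... | true  | false = refl
    ... | false | true  = refl
    ... | false | false = position-before hs i j

    before-swap : ∀ q {z y b i j} → (i , j) ≢ (z , y) → (i , j) ≢ (y , z) →
                  before (q ++ z ∷ y ∷ b) i j ≡ before (q ++ y ∷ z ∷ b) i j
    before-swap [] {z} {y} {b} {i} {j} n₁ n₂ with z ≟ j | y ≟ j | z ≟ i | y ≟ i
    ... | yes _    | yes _    | _        | _        = refl
    ... | yes refl | no _     | _        | yes refl = ⊥-elim (n₂ refl)
    ... | yes _    | no _     | _        | no _     = refl
    ... | no _     | yes refl | yes refl | _        = ⊥-elim (n₁ refl)
    ... | no _     | yes _    | no _     | _        = refl
    ... | no _     | no _     | yes _    | yes _    = refl
    ... | no _     | no _     | yes _    | no _     = refl
    ... | no _     | no _     | no _     | yes _    = refl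
    ... | no _     | no _     | no _     | no _     = refl
    before-swap (h ∷ q) {i = i} {j} n₁ n₂ =
      cong (λ c → if does (h ≟ j) then false else if does (h ≟ i) then true else c) (before-swap q n₁ n₂)

    before-true : ∀ p {x y s} → x ∉ p → y ∉ p → x ≢ y → before (p ++ x ∷ s) x y ≡ true
    before-true [] {x} {y} _ _ n rewrite dec-false (x ≟ y) n | dec-true (x ≟ x) refl = refl
    before-true (h ∷ p) {x} {y} nx ny n rewrite dec-false (h ≟ y) (ny ∘ here ∘ sym) | dec-false (h ≟ x) (nx ∘ here ∘ sym) =
      before-true p (nx ∘ there) (ny ∘ there) n

    before-false : ∀ p {x y s} → x ∉ p → y ∉ p → before (p ++ x ∷ s) y x ≡ false
    before-false [] {x} {y} _ _ rewrite dec-true (x ≟ x) refl = refl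
    before-false (h ∷ p) {x} {y} nx ny rewrite dec-false (h ≟ y) (ny ∘ here ∘ sym) | dec-false (h ≟ x) (nx ∘ here ∘ sym) =
      before-false p (nx ∘ there) (ny ∘ there)

    -- The left quotient of a set of words by the letter `x`.
    tails : A → List (List A) → List (List A)
    tails x []            = []
    tails x ([] ∷ H)      = tails x H
    tails x ((y ∷ s) ∷ H) = if does (x ≟ y) then s ∷ tails x H else tails x H

    ∈-tails⁻ : ∀ {x t} H → t ∈ tails x H → x ∷ t ∈ H
    ∈-tails⁻ ([] ∷ H) m = there (∈-tails⁻ H m)
    ∈-tails⁻ {x} ((y ∷ s) ∷ H) m with x ≟ y
    ∈-tails⁻ ((y ∷ s) ∷ H) (here refl) | yes refl = here refl
    ∈-tails⁻ ((y ∷ s) ∷ H) (there m)   | yes refl = there (∈-tails⁻ H m)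
    ∈-tails⁻ ((y ∷ s) ∷ H) m           | no _     = there (∈-tails⁻ H m)

    ∈-tails⁺ : ∀ {x t} H → x ∷ t ∈ H → t ∈ tails x H
    ∈-tails⁺ {x} (_ ∷ H) (here refl) rewrite dec-true (x ≟ x) refl = here refl
    ∈-tails⁺ ([] ∷ H) (there m) = ∈-tails⁺ H m
    ∈-tails⁺ {x} ((y ∷ s) ∷ H) (there m) with does (x ≟ y)
    ... | true  = there (∈-tails⁺ H m)
    ... | false = ∈-tails⁺ H m

    tails-unique : ∀ {x} H → Unique H → Unique (tails x H)
    tails-unique [] [] = []
    tails-unique ([] ∷ H) (_ ∷ u) = tails-unique H u
    tails-unique {x} ((y ∷ s) ∷ H) (s∉ ∷ u) with x ≟ y
    ... | yes refl = All.tabulate (λ { m refl → All.lookup s∉ (∈-tails⁻ H m) refl }) ∷ tails-unique H u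
    ... | no _     = tails-unique H u

    length-by-heads : ∀ {H xs B} → Unique H → (∀ {s} → s ∈ H → ∃₂ λ h t → s ≡ h ∷ t × h ∈ xs) →
                      (∀ z → length (tails z H) ≤ B) → length H ≤ length xs * B
    length-by-heads {H} {xs} {B} u heads fibre =
      ≤-trans (unique-⊆-length u cover) (total xs)
      where
      branches : List A → List (List A)
      branches xs = concatMap (λ x → map (x ∷_) (tails x H)) xs
      cover : ∀ {s} → s ∈ H → s ∈ branches xs
      cover s∈ with heads s∈
      ... | h , t , refl , h∈ = ∈-concat⁺′ (∈-map⁺ (h ∷_) (∈-tails⁺ H s∈)) (∈-map⁺ (λ x → map (x ∷_) (tails x H)) h∈)
      total : ∀ xs → length (branches xs) ≤ length xs * B
      total []       = z≤n
      total (x ∷ xs) = ≤-trans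
        (≤-reflexive (trans (length-++ (map (x ∷_) (tails x H))) (cong (_+ _) (length-map (x ∷_) (tails x H)))))
        (+-mono-≤ (fibre x) (total xs))

  -- Average number of sibling pairs in consecutive position

  module Adjacencies {_~_ : A → A → Set} (_~?_ : Decidable _~_) (~-sym : Symmetric _~_) where

    indicator : A → A → ℕ
    indicator x y = if does (x ~? y) then 1 else 0

    indicator-sym : ∀ x y → indicator x y ≡ indicator y x
    indicator-sym x y with x ~? y
    ... | yes s = sym (cong (if_then 1 else 0) (dec-true (y ~? x) (~-sym s)))
    ... | no n  = sym (cong (if_then 1 else 0) (dec-false (y ~? x) (n ∘ ~-sym)))

    first : A → List A → ℕ
    first x []      = 0
    first x (y ∷ _) = indicator x y

    adjacencies : List A → ℕ
    adjacencies []       = 0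
    adjacencies (x ∷ xs) = first x xs + adjacencies xs

    -- A neighbour of x is gained twice for each y ~ x (just before and just after y),
    -- and every old adjacency survives all but one of the insertions.
    adjacencies-inserts : ∀ x xs → sum (map adjacencies (inserts x xs)) ≤ length xs * adjacencies xs + 2 * row indicator x xs
    adjacencies-inserts x [] = z≤n
    adjacencies-inserts x (y ∷ ys) = begin
      (i + (f + a)) + sum (map adjacencies (map (y ∷_) (inserts x ys)))
        ≡⟨ cong ((i + (f + a)) +_) (split (inserts x ys)) ⟩
      (i + (f + a)) + (sum (map (first y) (inserts x ys)) + sum (map adjacencies (inserts x ys)))
        ≤⟨ +-monoʳ-≤ (i + (f + a)) (+-mono-≤ (≤-reflexive (firsts ys)) (adjacencies-inserts x ys)) ⟩
      (i + (f + a)) + ((indicator y x + l * f) + (l * a + 2 * r))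
        ≡⟨ cong (λ j → (i + (f + a)) + ((j + l * f) + (l * a + 2 * r))) (indicator-sym y x) ⟩
      (i + (f + a)) + ((i + l * f) + (l * a + 2 * r))
        ≡⟨ lem i f a l r ⟩
      suc l * (f + a) + 2 * (i + r) ∎
      where
      open ≤-Reasoning
      i = indicator x y
      f = first y ys
      a = adjacencies ys
      l = length ys
      r = row indicator x ys
      lem : ∀ i f a l r → (i + (f + a)) + ((i + l * f) + (l * a + 2 * r)) ≡ suc l * (f + a) + 2 * (i + r)
      lem = solve-∀
      split : ∀ Ls → sum (map adjacencies (map (y ∷_) Ls)) ≡ sum (map (first y) Ls) + sum (map adjacencies Ls)
      split []       = refl
      split (L ∷ Ls) = trans (cong (first y L + adjacencies L +_) (split Ls)) (interchange (first y L) (adjacencies L) _ _)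
      constant : ∀ z Ls → sum (map (first y) (map (z ∷_) Ls)) ≡ length Ls * indicator y z
      constant z []       = refl
      constant z (L ∷ Ls) = cong (indicator y z +_) (constant z Ls)
      -- One insertion puts `x` in front; each of the other `length ys` insertions keeps the first
      -- letter of `ys`.
      firsts : ∀ ys → sum (map (first y) (inserts x ys)) ≡ indicator y x + length ys * first y ys
      firsts []       = refl
      firsts (z ∷ ys) = cong (indicator y x +_)
        (trans (constant z (inserts x ys)) (cong (_* indicator y z) (length-inserts x ys)))

    -- The mean `2 * k` reproduces itself: the `l + 1` insertions into one word have at most `l`
    -- times its adjacencies plus `2 * k` in total, so a mean of at most `2 * k` before gives at
    -- most `(l * 2 * k + 2 * k) / (l + 1)` after.
    adjacencies-perms : ∀ {k} → (∀ x {ys} → Unique ys → row indicator x ys ≤ k) → ∀ {xs} → Unique xs →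
                        sum (map adjacencies (perms xs)) ≤ 2 * k * length (perms xs)
    adjacencies-perms {k} deg [] = z≤n
    adjacencies-perms {k} deg {x ∷ xs} (_ ∷ u) = begin
      sum (map adjacencies (concatMap (inserts x) (perms xs)))
        ≤⟨ go (perms xs) (λ m → ↭-length (perms-↭ xs m) , unique-↭ (↭-sym (perms-↭ xs m)) u) ⟩
      l * sum (map adjacencies (perms xs)) + 2 * k * length (perms xs)
        ≤⟨ +-monoˡ-≤ _ (*-monoʳ-≤ l (adjacencies-perms deg u)) ⟩
      l * (2 * k * length (perms xs)) + 2 * k * length (perms xs)
        ≡⟨ lem l k (length (perms xs)) ⟩
      2 * k * (suc l * length (perms xs))
        ≡⟨ cong (λ m → 2 * k * (suc l * m)) (length-perms xs) ⟩
      2 * k * (suc l * l !)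
        ≡⟨ cong (2 * k *_) (sym (length-perms (x ∷ xs))) ⟩
      2 * k * length (perms (x ∷ xs)) ∎
      where
      open ≤-Reasoning
      l = length xs
      lem : ∀ l k m → l * (2 * k * m) + 2 * k * m ≡ 2 * k * (suc l * m)
      lem = solve-∀
      lem′ : ∀ l k a b m → (l * a + 2 * k) + (l * b + 2 * k * m) ≡ l * (a + b) + 2 * k * suc m
      lem′ = solve-∀
      go : ∀ Ls → (∀ {ys} → ys ∈ Ls → length ys ≡ l × Unique ys) →
           sum (map adjacencies (concatMap (inserts x) Ls)) ≤ l * sum (map adjacencies Ls) + 2 * k * length Ls
      go [] h = z≤n
      go (ys ∷ Ls) h with h (here refl)
      ... | len , u = begin
        sum (map adjacencies (inserts x ys ++ concatMap (inserts x) Ls))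
          ≡⟨ trans (cong sum (map-++ adjacencies (inserts x ys) _)) (sum-++ (map adjacencies (inserts x ys)) _) ⟩
        sum (map adjacencies (inserts x ys)) + sum (map adjacencies (concatMap (inserts x) Ls))
          ≤⟨ +-mono-≤ (adjacencies-inserts x ys) (go Ls (h ∘ there)) ⟩
        (length ys * adjacencies ys + 2 * row indicator x ys) + (l * sum (map adjacencies Ls) + 2 * k * length Ls)
          ≤⟨ +-monoˡ-≤ _ (+-mono-≤ (≤-reflexive (cong (_* adjacencies ys) len)) (*-monoʳ-≤ 2 (deg x u))) ⟩
        (l * adjacencies ys + 2 * k) + (l * sum (map adjacencies Ls) + 2 * k * length Ls)
          ≡⟨ lem′ l k (adjacencies ys) _ (length Ls) ⟩
        l * sum (map adjacencies (ys ∷ Ls)) + 2 * k * length (ys ∷ Ls) ∎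

    degree-bound : ∀ {k x} (g : List A) → length g ≤ k → (∀ {y} → x ~ y → y ∈ g) →
                   ∀ {ys} → Unique ys → row indicator x ys ≤ k
    degree-bound {x = x} g len cover {ys} u = ≤-trans (≤-reflexive (count ys))
      (≤-trans (unique-⊆-length (Unique.filter⁺ (x ~?_) u) (λ m → cover (proj₂ (∈-filter⁻ (x ~?_) {xs = ys} m)))) len)
      where
      count : ∀ ys → row indicator x ys ≡ length (filter (x ~?_) ys)
      count []       = refl
      count (y ∷ ys) with does (x ~? y)
      ... | true  = cong suc (count ys)
      ... | false = count ys

-- Counting the words that share a leaf of the decision tree

module _ {A : Set} (_≟_ : DecidableEquality A)
         {_~_ : A → A → Set} (_~?_ : Decidable _~_) (~-sym : Symmetric _~_) (~-trans : Transitive _~_) where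

  open Adjacencies _~?_ ~-sym

  -- `V` stands for the words consistent with one path of answers. `V-swap` reflects that a pair on
  -- which two such words disagree was never compared; `V-~` is the only trace of the parity
  -- argument.
  module Prefixes
    (V : List A → Set)
    (V-unique : ∀ {L} → V L → Unique L)
    (V-↭ : ∀ {L M} → V L → V M → L ↭ M)
    (V-swap : ∀ q {z y b M} → V M → before _≟_ M y z ≡ true → before _≟_ M z y ≡ false → z ∉ q → y ∉ q → z ≢ y →
              V (q ++ z ∷ y ∷ b) → V (q ++ y ∷ z ∷ b))
    (V-~ : ∀ p {x y s} → x ≢ y → V (p ++ x ∷ y ∷ s) → V (p ++ y ∷ x ∷ s) → x ~ y) where

    split-unique : ∀ p {x : A} {s} → Unique (p ++ x ∷ s) → x ∉ p × x ∉ s × (∀ {z} → z ∈ s → z ∉ p)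
    split-unique p u with unique-++⁻ p u
    ... | _ , x∉ ∷ _ , d = (λ x∈ → d x∈ (here refl)) , (λ x∈ → All.lookup x∉ x∈ refl) , (λ z∈ z∈p → d z∈p (there z∈))

    -- The word `p ++ y ∷ s` has `y` before every letter of `c`, so it serves as the witness `M` for
    -- each exchange that carries `y` forward through `c`, last letter of `c` first.
    advance : ∀ {p y s} → V (p ++ y ∷ s) → ∀ c q {b} → (∀ {z} → z ∈ c → z ∈ s) →
              V (q ++ c ++ y ∷ b) → V (q ++ y ∷ c ++ b)
    advance v [] q sub w = w
    advance {p} {y} {s} v (z ∷ c) q {b} sub w
      with split-unique p (V-unique v)
    ... | y∉p , y∉s , s∉p = V-swap q v (before-true _≟_ p y∉p z∉p (z≢y ∘ sym)) (before-false _≟_ p y∉p z∉p) z∉q y∉q z≢y w′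
      where
      z∉p = s∉p (sub (here refl))
      z≢y : z ≢ y
      z≢y refl = y∉s (sub (here refl))
      w′ : V (q ++ z ∷ y ∷ c ++ b)
      w′ = subst V (++-assoc q [ z ] _) (advance v c (q ++ [ z ]) (sub ∘ there) (subst V (sym (++-assoc q [ z ] _)) w))
      z∉q : z ∉ q
      z∉q = proj₁ (split-unique q (V-unique w′))
      y∉q : y ∉ q
      y∉q = proj₂ (proj₂ (split-unique q (V-unique w′))) (here refl)

    -- Both words share `p`, so `x` and all letters between `x` and `y` in the first word come after
    -- `y` in the second. The second word therefore licenses moving `y` up to `x` and past it.
    branch : ∀ p {x y s s′} → x ≢ y → V (p ++ x ∷ s) → V (p ++ y ∷ s′) →
             x ~ y × y ∈ s × ∃[ t ] V (p ++ x ∷ y ∷ t)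
    branch p {x} {y} {s} {s′} x≢y v w = go (∈-∃++ y∈s)
      where
      y∉p = proj₁ (split-unique p (V-unique w))
      x∉p = proj₁ (split-unique p (V-unique v))
      y∈s : y ∈ s
      y∈s with ∈-++⁻ p (∈-resp-↭ (V-↭ w v) (∈-++⁺ʳ p (here refl)))
      ... | inj₁ y∈p = ⊥-elim (y∉p y∈p)
      ... | inj₂ (here refl) = ⊥-elim (x≢y refl)
      ... | inj₂ (there y∈s) = y∈s
      go : (∃₂ λ a b → s ≡ a ++ y ∷ b) → x ~ y × y ∈ s × ∃[ t ] V (p ++ x ∷ y ∷ t)
      -- `v′` has `y` directly behind `x`; one more exchange puts it in front, and these two words
      -- differ only in the order of `x` and `y`.
      go (a , b , refl) = V-~ p x≢y v′ (advance w [ x ] p (λ { (here refl) → x∈s′ }) v′) , y∈s , a ++ b , v′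
        where
        follows : ∀ {z} → z ∉ p → z ≢ y → z ∈ p ++ x ∷ a ++ y ∷ b → z ∈ s′
        follows z∉p z≢y z∈ with ∈-++⁻ p (∈-resp-↭ (V-↭ v w) z∈)
        ... | inj₁ z∈p = ⊥-elim (z∉p z∈p)
        ... | inj₂ (here refl) = ⊥-elim (z≢y refl)
        ... | inj₂ (there z∈s′) = z∈s′
        x∈s′ : x ∈ s′
        x∈s′ = follows x∉p x≢y (∈-++⁺ʳ p (here refl))
        a⊆s′ : ∀ {z} → z ∈ a → z ∈ s′
        a⊆s′ z∈a = follows (proj₂ (proj₂ (split-unique p (V-unique v))) (∈-++⁺ˡ z∈a))
          (λ { refl → proj₁ (split-unique (p ++ x ∷ a)
                 (subst Unique (sym (++-assoc p (x ∷ a) _)) (V-unique v))) (∈-++⁺ʳ p (there z∈a)) })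
          (∈-++⁺ʳ p (there (∈-++⁺ˡ z∈a)))
        v′ : V (p ++ x ∷ y ∷ a ++ b)
        v′ = subst V (++-assoc p [ x ] _) (advance w a (p ++ [ x ]) a⊆s′ (subst V (sym (++-assoc p [ x ] _)) v))

    -- After `x` the first word continues with `h`, while `branch` yields another word that
    -- continues with `y`. If `h` differs from `y`, the longer prefix branches too, so `h ~ y`, and
    -- `x ~ y` connects `h` to `x`.
    branch-first : ∀ p {x y s s′} → x ≢ y → V (p ++ x ∷ s) → V (p ++ y ∷ s′) → first x s ≡ 1
    branch-first p {x} {y} {[]} x≢y v w with branch p x≢y v w
    ... | _ , () , _
    branch-first p {x} {y} {h ∷ s} x≢y v w with branch p x≢y v w
    ... | x~y , _ , t , v′ = cong (if_then 1 else 0) (dec-true (x ~? h) x~h)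
      where
      x~h : x ~ h
      x~h with h ≟ y
      ... | yes refl = x~y
      ... | no h≢y = ~-trans x~y (~-sym (proj₁ (branch (p ++ [ x ]) h≢y
              (subst V (sym (++-assoc p [ x ] _)) v) (subst V (sym (++-assoc p [ x ] _)) v′))))

    HeadOtherThan : A → List A → Set
    HeadOtherThan x s = ∃₂ λ y t → s ≡ y ∷ t × x ≢ y

    headOtherThan? : ∀ x s → Dec (HeadOtherThan x s)
    headOtherThan? x []      = no λ { (_ , _ , () , _) }
    headOtherThan? x (y ∷ t) with x ≟ y
    ... | yes refl = no λ { (_ , _ , refl , n) → n refl }
    ... | no n     = yes (y , t , refl , n)

    -- Where a prefix branches, all continuations are siblings and each of them is
    -- followed by a further sibling, so that the branching is paid for by an adjacency.
    module _ (K : ℕ) .{{_ : NonZero K}} (class : ∀ x → Σ[ g ∈ List A ] length g ≤ K × (∀ {y} → x ~ y → y ∈ g)) where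

      count : ∀ l p m {H} → Unique H →
              (∀ {s} → s ∈ H → V (p ++ s) × length s ≡ l × adjacencies s ≤ m) → length H ≤ K ^ m
      count zero p m {[]} u h = z≤n
      count zero p m {_ ∷ []} u h = m^n>0 K m
      count zero p m {s ∷ t ∷ H} ((s≢t ∷ _) ∷ _) h
        with s | t | proj₁ (proj₂ (h (here refl))) | proj₁ (proj₂ (h (there (here refl))))
      ... | [] | [] | _ | _ = ⊥-elim (s≢t refl)
      count (suc l) p m {[]} u h = z≤n
      count (suc l) p m {[] ∷ H} u h with proj₁ (proj₂ (h (here refl)))
      ... | ()
      count (suc l) p m {(x ∷ s) ∷ H} u h with Any.any? (headOtherThan? x) ((x ∷ s) ∷ H)
      ... | no none = ≤-trans (length-by-heads _≟_ {xs = [ x ]} u heads fibre) (≤-reflexive (*-identityˡ (K ^ m)))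
        where
        heads : ∀ {s′} → s′ ∈ (x ∷ s) ∷ H → ∃₂ λ h t → s′ ≡ h ∷ t × h ∈ [ x ]
        heads {[]} s∈ with proj₁ (proj₂ (h s∈))
        ... | ()
        heads {y ∷ t} s∈ with x ≟ y
        ... | yes refl = x , t , refl , here refl
        ... | no n = ⊥-elim (none (lose s∈ (y , t , refl , n)))
        fibre : ∀ z → length (tails _≟_ z ((x ∷ s) ∷ H)) ≤ K ^ m
        fibre z = count l (p ++ [ z ]) m (tails-unique _≟_ _ u) λ {t} t∈ →
          let v , e , b = h (∈-tails⁻ _≟_ _ t∈) in
          subst V (sym (++-assoc p [ z ] t)) v , suc-injective e , m+n≤o⇒n≤o (first z t) b
      ... | yes some with find some
      ...   | _ , y∈ , (y , s₂ , refl , x≢y) = go m refl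
        where
        vx = proj₁ (h (here refl))
        vy = proj₁ (h y∈)
        -- At least one of `x` and `y` differs from `z`, so every continuation has a rival, and
        -- `branch-first` applies to all of them.
        other : ∀ z → ∃₂ λ w t → z ≢ w × V (p ++ w ∷ t)
        other z with z ≟ x
        ... | yes refl = y , s₂ , x≢y , vy
        ... | no z≢x   = x , s , z≢x , vx
        -- Reflexivity of `_~_` is not assumed; `x ~ x` comes from going to the rival `y` and back.
        x~ : ∀ {z t} → V (p ++ z ∷ t) → x ~ z
        x~ {z} v with x ≟ z
        ... | no x≢z = proj₁ (branch p x≢z vx v)
        ... | yes refl = let x~y = proj₁ (branch p x≢y vx vy) in ~-trans x~y (~-sym x~y)
        first≡1 : ∀ {z t} → V (p ++ z ∷ t) → first z t ≡ 1
        first≡1 {z} v = let w , _ , z≢w , v′ = other z in branch-first p z≢w v v′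
        heads : ∀ {s′} → s′ ∈ (x ∷ s) ∷ H → ∃₂ λ h t → s′ ≡ h ∷ t × h ∈ proj₁ (class x)
        heads {[]} s∈ with proj₁ (proj₂ (h s∈))
        ... | ()
        heads {z ∷ t} s∈ = z , t , refl , proj₂ (proj₂ (class x)) (x~ (proj₁ (h s∈)))
        paid : ∀ {z t} → z ∷ t ∈ (x ∷ s) ∷ H → suc (adjacencies t) ≤ m
        paid {z} {t} s∈ = let v , _ , b = h s∈ in subst (λ i → i + adjacencies t ≤ m) (first≡1 v) b
        go : ∀ m′ → m ≡ m′ → suc (length H) ≤ K ^ m′
        -- With an empty budget there is no branching, because the adjacency behind `x` already
        -- exceeds it.
        go zero refl with paid (here refl)
        ... | ()
        go (suc m′) refl = ≤-trans (length-by-heads _≟_ u heads fibre) (*-monoˡ-≤ (K ^ m′) (proj₁ (proj₂ (class x))))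
          where
          fibre : ∀ z → length (tails _≟_ z ((x ∷ s) ∷ H)) ≤ K ^ m′
          fibre z = count l (p ++ [ z ]) m′ (tails-unique _≟_ _ u) λ {t} t∈ →
            let v , e , b = h (∈-tails⁻ _≟_ _ t∈) in
            subst V (sym (++-assoc p [ z ] t)) v , suc-injective e , s≤s⁻¹ (paid (∈-tails⁻ _≟_ _ t∈))

-- Decision trees

n≤2^⌈log₂n⌉ : ∀ n → n ≤ 2 ^ ⌈log₂ n ⌉
n≤2^⌈log₂n⌉ = <-rec _ go
  where
  go : ∀ n → (∀ {m} → m < n → m ≤ 2 ^ ⌈log₂ m ⌉) → n ≤ 2 ^ ⌈log₂ n ⌉
  go zero _ = z≤n
  go (suc zero) _ = ≤-refl
  go n@(suc (suc n′)) rec = begin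
    n                                  ≡⟨ ⌊n/2⌋+⌈n/2⌉≡n n ⟨
    ⌊ n /2⌋ + ⌈ n /2⌉                  ≤⟨ +-monoˡ-≤ ⌈ n /2⌉ (⌊n/2⌋≤⌈n/2⌉ n) ⟩
    ⌈ n /2⌉ + ⌈ n /2⌉                  ≡⟨ cong (⌈ n /2⌉ +_) (+-identityʳ _) ⟨
    2 * ⌈ n /2⌉                        ≤⟨ *-monoʳ-≤ 2 (rec (⌈n/2⌉<n n′)) ⟩
    2 * 2 ^ ⌈log₂ ⌈ n /2⌉ ⌉            ≡⟨ cong (λ l → 2 * 2 ^ l) (⌈log₂⌈n/2⌉⌉≡⌈log₂n⌉∸1 n) ⟩
    2 ^ suc (⌈log₂ n ⌉ ∸ 1)            ≡⟨ cong (2 ^_) (m+[n∸m]≡n (⌈log₂⌉-mono-≤ {2} {n} (s≤s (s≤s z≤n)))) ⟩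
    2 ^ ⌈log₂ n ⌉                      ∎
    where open ≤-Reasoning

module _ {n : ℕ} where

  -- Running on a bare comparator lets words be fed to the tree directly; a permutation is chosen
  -- only where correctness or the final cost is invoked.
  runWith : (Fin n → Fin n → Bool) → DTree n → ℕ
  runWith c (output m) = m
  runWith c (query i j D E) = if c i j then runWith c D else runWith c E

  costWith : (Fin n → Fin n → Bool) → DTree n → ℕ
  costWith c (output m) = 0
  costWith c (query i j D E) = suc (if c i j then costWith c D else costWith c E)

  Answers : Set
  Answers = List ((Fin n × Fin n) × Bool)

  Consistent : Answers → (Fin n → Fin n → Bool) → Set
  Consistent Q c = All (λ ((i , j) , b) → c i j ≡ b) Q

  -- Always following the answer shared by the larger part of the surviving comparators
  -- costs a factor of at most two per query.
  majority : {X : Set} (c : X → Fin n → Fin n → Bool) (D : DTree n) {G : List X} → 0 < length G → Unique G →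
    Σ[ Q ∈ Answers ] Σ[ m ∈ ℕ ] (∀ x → Consistent Q (c x) → runWith (c x) D ≡ m) ×
    Σ[ x ∈ X ] x ∈ G × Σ[ H ∈ List X ] Unique H × (∀ {y} → y ∈ H → y ∈ G × Consistent Q (c y)) ×
    length G ≤ 2 ^ costWith (c x) D * length H
  majority c (output m) {x ∷ G} _ u =
    [] , m , (λ _ _ → refl) , x , here refl , x ∷ G , u , (λ y∈ → y∈ , []) , ≤-reflexive (sym (*-identityˡ _))
  majority {X} c (query i j D E) {G} ne u = go (≤-total (part false) (part true))
    where
    is : Bool → List X
    is b = filter (λ x → c x i j Bool.≟ b) G
    part : Bool → ℕ
    part b = length (is b)
    parts : ∀ G → length G ≡ length (filter (λ x → c x i j Bool.≟ true) G) + length (filter (λ x → c x i j Bool.≟ false) G)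
    parts []      = refl
    parts (x ∷ G) with c x i j
    ... | true  = cong suc (parts G)
    ... | false = trans (cong suc (parts G)) (sym (+-suc _ _))
    double : ∀ {a b} → length G ≡ a + b → b ≤ a → length G ≤ 2 * a
    double {a} e le = ≤-trans (≤-reflexive e) (+-monoʳ-≤ a (≤-trans le (≤-reflexive (sym (+-identityʳ a)))))
    nonempty : ∀ {a} → length G ≤ 2 * a → 0 < a
    nonempty {zero}  le = <-≤-trans ne le
    nonempty {suc _} _  = z<s
    step : ∀ b D′ → (∀ x → c x i j ≡ b → runWith (c x) (query i j D E) ≡ runWith (c x) D′ ×
                                         costWith (c x) (query i j D E) ≡ suc (costWith (c x) D′)) →
      length G ≤ 2 * part b →
      Σ[ Q ∈ Answers ] Σ[ m ∈ ℕ ] (∀ x → Consistent Q (c x) → runWith (c x) D′ ≡ m) ×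
      Σ[ x ∈ X ] x ∈ is b × Σ[ H ∈ List X ] Unique H × (∀ {y} → y ∈ H → y ∈ is b × Consistent Q (c y)) ×
      length (is b) ≤ 2 ^ costWith (c x) D′ * length H →
      Σ[ Q ∈ Answers ] Σ[ m ∈ ℕ ] (∀ x → Consistent Q (c x) → runWith (c x) (query i j D E) ≡ m) ×
      Σ[ x ∈ X ] x ∈ G × Σ[ H ∈ List X ] Unique H × (∀ {y} → y ∈ H → y ∈ G × Consistent Q (c y)) ×
      length G ≤ 2 ^ costWith (c x) (query i j D E) * length H
    step b D′ eq le (Q , m , run , x , x∈ , H , uH , sub , len) =
      ((i , j) , b) ∷ Q , m , (λ { y (e ∷ q) → trans (proj₁ (eq y e)) (run y q) })
      , x , proj₁ (mem x∈) , H , uH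
      , (λ y∈ → let y∈is , q = sub y∈ in proj₁ (mem y∈is) , proj₂ (mem y∈is) ∷ q)
      , (begin
          length G                                           ≤⟨ le ⟩
          2 * part b                                         ≤⟨ *-monoʳ-≤ 2 len ⟩
          2 * (2 ^ costWith (c x) D′ * length H)             ≡⟨ *-assoc 2 (2 ^ costWith (c x) D′) (length H) ⟨
          2 ^ suc (costWith (c x) D′) * length H             ≡⟨ cong (λ k → 2 ^ k * length H) (proj₂ (eq x (proj₂ (mem x∈)))) ⟨
          2 ^ costWith (c x) (query i j D E) * length H      ∎)
      where
      open ≤-Reasoning
      mem : ∀ {y} → y ∈ is b → y ∈ G × c y i j ≡ b
      mem = ∈-filter⁻ (λ x → c x i j Bool.≟ b)
    both : ∀ {b} x → c x i j ≡ b →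
           runWith (c x) (query i j D E) ≡ runWith (c x) (if b then D else E) ×
           costWith (c x) (query i j D E) ≡ suc (costWith (c x) (if b then D else E))
    both x refl with c x i j
    ... | true  = refl , refl
    ... | false = refl , refl
    go : part false ≤ part true ⊎ part true ≤ part false → _
    go (inj₁ le) = step true D both le′
                     (majority c D (nonempty le′) (Unique.filter⁺ (λ x → c x i j Bool.≟ true) u))
      where le′ = double (parts G) le
    go (inj₂ le) = step false E both le′
                     (majority c E (nonempty le′) (Unique.filter⁺ (λ x → c x i j Bool.≟ false) u))
      where le′ = double (trans (parts G) (+-comm (part true) (part false))) le

  module _ {c : Fin n → Fin n → Bool} (ρ : Permutation′ n) (eq : ∀ i j → does (rk ρ i <? rk ρ j) ≡ c i j) where

    run-runWith : ∀ D → run ρ D ≡ runWith c D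
    run-runWith (output m) = refl
    run-runWith (query i j D E) rewrite eq i j with c i j
    ... | true  = run-runWith D
    ... | false = run-runWith E

    cost-costWith : ∀ D → cost ρ D ≡ costWith c D
    cost-costWith (output m) = refl
    cost-costWith (query i j D E) rewrite eq i j with c i j
    ... | true  = cong suc (cost-costWith D)
    ... | false = cong suc (cost-costWith E)

-- From words to permutations

module _ {A : Set} (_≟_ : DecidableEquality A) where

  position-< : ∀ {x L} → x ∈ L → position _≟_ L x < length L
  position-< {x} {y ∷ L} x∈ with y ≟ x
  ... | yes _ = z<s
  position-< (here refl) | no n = ⊥-elim (n refl)
  position-< (there x∈)  | no n = s≤s (position-< x∈)

  position-lookup : ∀ {L} → Unique L → ∀ i → position _≟_ L (lookup L i) ≡ toℕ i
  position-lookup {y ∷ L} (y∉ ∷ u) Fin.zero rewrite dec-true (y ≟ y) refl = refl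
  position-lookup {y ∷ L} (y∉ ∷ u) (Fin.suc i)
    rewrite dec-false (y ≟ lookup L i) (All.lookup y∉ (∈-lookup i)) = cong suc (position-lookup u i)

  lookup-position : ∀ {L x} → x ∈ L → ∀ i → toℕ i ≡ position _≟_ L x → lookup L i ≡ x
  lookup-position {y ∷ L} {x} x∈ i e with y ≟ x
  lookup-position x∈ Fin.zero e | yes refl = refl
  lookup-position (here refl) _ _ | no n = ⊥-elim (n refl)
  lookup-position (there x∈) (Fin.suc i) e | no n = lookup-position x∈ i (suc-injective e)

ranking : ∀ {n} {L : List (Fin n)} → L ↭ allFin n → Σ[ ρ ∈ Permutation′ n ] ∀ x → rk ρ x ≡ position Fin._≟_ L x
ranking {n} {L} p = permutation to from to-from from-to , λ x → toℕ-fromℕ< (bound x)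
  where
  len : length L ≡ n
  len = trans (↭-length p) (length-tabulate {n = n} (λ i → i))
  member : ∀ x → x ∈ L
  member x = ∈-resp-↭ (↭-sym p) (∈-allFin x)
  bound : ∀ x → position Fin._≟_ L x < n
  bound x = subst (position Fin._≟_ L x <_) len (position-< Fin._≟_ (member x))
  to : Fin n → Fin n
  to x = fromℕ< (bound x)
  from : Fin n → Fin n
  from i = lookup L (Fin.cast (sym len) i)
  to-from : ∀ i → to (from i) ≡ i
  to-from i = toℕ-injective (trans (toℕ-fromℕ< (bound (from i)))
    (trans (position-lookup Fin._≟_ (unique-↭ (↭-sym p) (allFin⁺ n)) _) (toℕ-cast (sym len) i)))
  from-to : ∀ x → from (to x) ≡ x
  from-to x = lookup-position Fin._≟_ (member x) _ (trans (toℕ-cast (sym len) (to x)) (toℕ-fromℕ< (bound x)))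

Inv-pairs : ∀ {n} (ρ : Permutation′ n) σ → Inv ρ σ ≡ pairs (λ x y → if does (rk ρ y <? rk ρ x) then 1 else 0) σ
Inv-pairs ρ [] = refl
Inv-pairs ρ (x ∷ σ) = cong₂ _+_ (countBelow-row σ) (Inv-pairs ρ σ)
  where
  countBelow-row : ∀ σ → countBelow ρ x σ ≡ row (λ x y → if does (rk ρ y <? rk ρ x) then 1 else 0) x σ
  countBelow-row []      = refl
  countBelow-row (y ∷ σ) = cong (_ +_) (countBelow-row σ)

rk-injective : ∀ {n} (ρ : Permutation′ n) {x y} → rk ρ x ≡ rk ρ y → x ≡ y
rk-injective ρ e = Injection.injective (↔⇒↣ ρ) (toℕ-injective e)

exponent-bound : ∀ {f a b} c l k → f ≤ 2 * a → a ≤ 2 ^ c * b → b ≤ (2 ^ l) ^ (4 * k) → f ≤ 2 ^ (c + 4 * (1 + k * l))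
exponent-bound {f} {a} {b} c l k f≤ a≤ b≤ = begin
  f                                     ≤⟨ f≤ ⟩
  2 * a                                 ≤⟨ *-monoʳ-≤ 2 a≤ ⟩
  2 * (2 ^ c * b)                       ≤⟨ *-monoʳ-≤ 2 (*-monoʳ-≤ (2 ^ c) b≤) ⟩
  2 * (2 ^ c * (2 ^ l) ^ (4 * k))       ≡⟨ cong (λ z → 2 * (2 ^ c * z)) (^-*-assoc 2 l (4 * k)) ⟩
  2 * (2 ^ c * 2 ^ (l * (4 * k)))       ≡⟨ cong (2 *_) (^-distribˡ-+-* 2 c (l * (4 * k))) ⟨
  -- The exponent needs only one unit for the factor two of Markov's inequality; three spare units
  -- let the constant 4 be factored out of both terms.
  2 ^ suc (c + l * (4 * k))             ≤⟨ ^-monoʳ-≤ 2 (m≤n+m (suc (c + l * (4 * k))) 3) ⟩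
  2 ^ (3 + suc (c + l * (4 * k)))       ≡⟨ cong (2 ^_) (lem c l k) ⟩
  2 ^ (c + 4 * (1 + k * l))             ∎
  where
  open ≤-Reasoning
  lem : ∀ c l k → 3 + suc (c + l * (4 * k)) ≡ c + 4 * (1 + k * l)
  lem = solve-∀

-- Combining parity, majority path and count

module LowerBound {n k : ℕ} (T : LTree (Fin n)) (labels : leaves T ↭ allFin n)
  (bound : All (_≤ k) (lcsList T)) (odd≤1 : oddCount T ≤ 1) (ancestors : AncestorsEmpty T)
  (D : DTree n) (solves : SolvesMInv T D) where

  leaves-unique : Unique (leaves T)
  leaves-unique = unique-↭ (↭-sym labels) (allFin⁺ n)

  open FromTree Fin._≟_ T leaves-unique
  open Siblings {_~_ = _~_} ~-sym _~?_
  open Adjacencies _~?_ ~-sym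

  before′ : List (Fin n) → Fin n → Fin n → Bool
  before′ = before Fin._≟_

  Represents : Permutation′ n → List (Fin n) → Set
  Represents ρ L = ∀ i j → does (rk ρ i <? rk ρ j) ≡ before′ L i j

  represent : ∀ {L} → L ↭ allFin n → Σ[ ρ ∈ Permutation′ n ] Represents ρ L
  represent {L} p = let ρ , e = ranking p in
    ρ , λ i j → trans (cong₂ (λ a b → does (a <? b)) (e i) (e j)) (position-before Fin._≟_ L i j)

  output-parity : (ρ : Permutation′ n) →
    run ρ D ≡₂ pairs (Ranked.nonsib (rk ρ) (rk-injective ρ)) (leaves T)
  output-parity ρ with solves ρ
  ... | (σ , y , e) , least = Ranked.minimum-parity (rk ρ) (rk-injective ρ) (tree-good odd≤1 ancestors)
    (σ , y , trans (sym (Inv-pairs ρ σ)) e) (λ τ y′ → subst (run ρ D ≤_) (Inv-pairs ρ τ) (least τ y′))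

  -- Both words produce the same output, whereas for non-siblings the parity of the correct output
  -- would change: of the comparisons between distinct leaves only that of `x` and `y` is reversed.
  swap-siblings : ∀ p {x y s m} → x ≢ y → (v : p ++ x ∷ y ∷ s ↭ allFin n) (w : p ++ y ∷ x ∷ s ↭ allFin n) →
                  runWith (before′ (p ++ x ∷ y ∷ s)) D ≡ m → runWith (before′ (p ++ y ∷ x ∷ s)) D ≡ m → x ~ y
  swap-siblings p {x} {y} {s} {m} x≢y v w ev ew =
    let ρ , rep = represent v ; ρ′ , rep′ = represent w in go ρ ρ′ rep rep′
    where
    go : (ρ ρ′ : Permutation′ n) → Represents ρ (p ++ x ∷ y ∷ s) → Represents ρ′ (p ++ y ∷ x ∷ s) → x ~ y
    go ρ ρ′ rep rep′ = decidable-stable (x ~? y) λ x≁y →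
      n≢₂1+n (pairs (Ranked.nonsib (rk ρ′) (rk-injective ρ′)) (leaves T))
        (trans (sym (output-parity ρ′)) (trans (cong parity same) (trans (output-parity ρ)
          (nonsib-flip (rk ρ) (rk ρ′) (rk-injective ρ) (rk-injective ρ′) x≢y x≁y agree flip-xy flip-yx
            leaves-unique (member x) (member y)))))
      where
      same : run ρ′ D ≡ run ρ D
      same = trans (run-runWith ρ′ rep′ D) (trans ew (trans (sym ev) (sym (run-runWith ρ rep D))))
      member : ∀ z → z ∈ leaves T
      member z = ∈-resp-↭ (↭-sym labels) (∈-allFin z)
      one : Bool → ℕ
      one = if_then 1 else 0
      agree : ∀ {a b} → (a , b) ≢ (x , y) → (a , b) ≢ (y , x) →
              one (does (rk ρ b <? rk ρ a)) ≡ one (does (rk ρ′ b <? rk ρ′ a))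
      agree {a} {b} n₁ n₂ = cong one (trans (rep b a) (trans
        (before-swap Fin._≟_ p (λ { refl → n₂ refl }) (λ { refl → n₁ refl })) (sym (rep′ b a))))
      disjoint = proj₂ (proj₂ (unique-++⁻ p (unique-↭ (↭-sym v) (allFin⁺ n))))
      x∉p : x ∉ p
      x∉p x∈ = disjoint x∈ (here refl)
      y∉p : y ∉ p
      y∉p y∈ = disjoint y∈ (there (here refl))
      flip-xy : one (does (rk ρ y <? rk ρ x)) ≡₂ suc (one (does (rk ρ′ y <? rk ρ′ x)))
      flip-xy = trans (cong (parity ∘ one) (trans (rep y x) (before-false Fin._≟_ p x∉p y∉p)))
        (cong (parity ∘ suc ∘ one) (sym (trans (rep′ y x) (before-true Fin._≟_ p y∉p x∉p (x≢y ∘ sym)))))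
      flip-yx : one (does (rk ρ x <? rk ρ y)) ≡₂ suc (one (does (rk ρ′ x <? rk ρ′ y)))
      flip-yx = trans (cong (parity ∘ one) (trans (rep x y) (before-true Fin._≟_ p x∉p y∉p x≢y)))
        (cong (parity ∘ suc ∘ one) (sym (trans (rep′ x y) (before-false Fin._≟_ p y∉p x∉p))))

  Compatible : Answers → List (Fin n) → Set
  Compatible Q L = L ↭ allFin n × Consistent Q (before′ L)

  -- A recorded answer about `y` and `z` would have to hold both for `M` and for the given word,
  -- which order them oppositely. All other answers are unaffected by the exchange.
  compatible-swap : ∀ {Q} q {z y b M} → Compatible Q M → before′ M y z ≡ true → before′ M z y ≡ false →
                    z ∉ q → y ∉ q → z ≢ y → Compatible Q (q ++ z ∷ y ∷ b) → Compatible Q (q ++ y ∷ z ∷ b)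
  compatible-swap {Q} q {z} {y} {b} {M} (_ , cM) yz zy z∉ y∉ z≢y (p , c) =
    ↭trans (++⁺ˡ q (swap y z refl)) p , All.zipWith (λ {a} → answer a) (cM , c)
    where
    answer : (a : (Fin n × Fin n) × Bool) → let ((i , j) , v) = a in
             before′ M i j ≡ v × before′ (q ++ z ∷ y ∷ b) i j ≡ v → before′ (q ++ y ∷ z ∷ b) i j ≡ v
    answer ((i , j) , v) (eM , e) with ≡-dec Fin._≟_ Fin._≟_ (i , j) (z , y) | ≡-dec Fin._≟_ Fin._≟_ (i , j) (y , z)
    ... | no n₁ | no n₂ = trans (sym (before-swap Fin._≟_ q n₁ n₂)) e
    ... | yes refl | _ with trans (sym zy) (trans eM (trans (sym e) (before-true Fin._≟_ q z∉ y∉ z≢y)))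
    ...   | ()
    answer ((i , j) , v) (eM , e) | no _ | yes refl with trans (sym yz) (trans eM (trans (sym e) (before-false Fin._≟_ q z∉ y∉)))
    ...   | ()

  -- Rounding `k` up to a power of two turns the count into an exponent of two and keeps the base
  -- positive when `k` is zero.
  K = 2 ^ ⌈log₂ k ⌉

  instance
    K≢0 : NonZero K
    K≢0 = m^n≢0 2 ⌈log₂ k ⌉

  compatible-count : ∀ {Q m l H} → (∀ L → Consistent Q (before′ L) → runWith (before′ L) D ≡ m) → Unique H →
    (∀ {L} → L ∈ H → Compatible Q L × adjacencies L ≤ l) → length H ≤ K ^ l
  compatible-count {Q} {l = l} run u h =
    Prefixes.count Fin._≟_ _~?_ ~-sym ~-trans (Compatible Q)
      (λ (p , _) → unique-↭ (↭-sym p) (allFin⁺ n))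
      (λ (p , _) (q , _) → ↭trans p (↭-sym q))
      compatible-swap
      (λ p {x} {y} {s} x≢y (v , cv) (w , cw) →
        swap-siblings p x≢y v w (run (p ++ x ∷ y ∷ s) cv) (run (p ++ y ∷ x ∷ s) cw))
      K (λ x → let g , len , cover = ~-bounded bound x in g , ≤-trans len (n≤2^⌈log₂n⌉ k) , cover)
      n [] l u
      (λ L∈ → let v , a = h L∈ in v , trans (↭-length (proj₁ v)) (length-tabulate {n = n} (λ i → i)) , a)

  few : List (List (Fin n))
  few = filter (λ L → adjacencies L ≤? 4 * k) (perms (allFin n))

  n!≤2*few : n ! ≤ 2 * length few
  n!≤2*few = subst (_≤ 2 * length few) (trans (length-perms (allFin n)) (cong _! (length-tabulate {n = n} (λ i → i))))
    (markov adjacencies k (perms (allFin n)) (adjacencies-perms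
      (λ x → let g , len , cover = ~-bounded bound x in degree-bound g len cover) (allFin⁺ n)))

  0<few : 0 < length few
  0<few = *-cancelˡ-< 2 0 (length few) (<-≤-trans (n≢0⇒n>0 (≢-nonZero⁻¹ (n !) {{n !≢0}})) n!≤2*few)

  few-unique : Unique few
  few-unique = Unique.filter⁺ _ (perms-unique Fin._≟_ (allFin⁺ n))

  few-∈ : ∀ {L} → L ∈ few → L ↭ allFin n × adjacencies L ≤ 4 * k
  few-∈ L∈ = let L∈perms , a = ∈-filter⁻ (λ L → adjacencies L ≤? 4 * k) L∈ in perms-↭ (allFin n) L∈perms , a

  -- The ranking comes from a word of `few` that follows the majority answers to the end, so its
  -- cost is exactly the number of halvings suffered by `few`; the survivors `H` are then bounded by
  -- `compatible-count`.
  hard-ranking : Σ[ ρ ∈ Permutation′ n ] n ! ≤ 2 ^ (cost ρ D + 4 * (1 + k * ⌈log₂ k ⌉))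
  hard-ranking =
    let Q , m , run , L , L∈ , H , uH , sub , len = majority before′ D 0<few few-unique
        ρ , rep = represent (proj₁ (few-∈ L∈))
        member : ∀ {M} → M ∈ H → Compatible Q M × adjacencies M ≤ 4 * k
        member M∈ = let M∈few , q = sub M∈ ; p , a = few-∈ M∈few in (p , q) , a
    in ρ , exponent-bound (cost ρ D) ⌈log₂ k ⌉ k n!≤2*few
         (subst (λ c → length few ≤ 2 ^ c * length H) (sym (cost-costWith ρ rep D)) len)
         (compatible-count run uH member)

mainTheorem3 : Σ ℕ λ C → (n k : ℕ) (T : LTree (Fin n)) →
    leaves T ↭ allFin n →
    NoUnary T →
    All (_≤ k) (lcsList T) →
    oddCount T ≤ 1 →
    AncestorsEmpty T →
    (D : DTree n) → SolvesMInv T D →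
    Σ (Permutation′ n) λ ρ → n ! ≤ 2 ^ (cost ρ D + C * (1 + k * ⌈log₂ k ⌉))
mainTheorem3 = 4 , λ n k T labels _ bound odd ancestors D solves →
  LowerBound.hard-ranking T labels bound odd ancestors D solves
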